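{- Let $P$ be a poset with no infinite antichain and $\alpha$ a countable ordinal. The following are equivalent: (i) $P$ is $\alpha$-bqo; (ii) $(P;\leq_{succ})$ is $\alpha$-bqo; (iii) $(P;\leq_{pred})$ is $\alpha$-bqo; (iv) $(P;\leq_{crit})$ is $\alpha$-bqo; (v) $AM(P)$ is $\alpha$-bqo.
   Context: For $a,b\in P$: $a\leq_{pred} b$ iff every $x\in P$ with $x<a$ satisfies $x<b$; $a\leq_{succ} b$ iff every $y\in P$ with $b<y$ satisfies $a<y$; $a\leq_{crit} b$ iff both $a\leq_{pred} b$ and $a\leq_{succ} b$. These are quasi-orders on $P$. $AM(P)$ is the set of maximal antichains of $P$, ordered by domination: $X\leq Y$ iff for every $x\in X$ there is $y\in Y$ with $x\leq y$. Barriers and $\alpha$-bqo: finite subsets of $\mathbb{N}$ are identified with their increasing enumerations. For finite $s,t\subseteq\mathbb{N}$ write $s\triangleleft t$ if there is a finite $r\subseteq\mathbb{N}$ such that $s$ is a proper initial segment of $r$ and $t$ is $r$ with its least element removed. A barrier is an infinite set $B$ of finite subsets of $\mathbb{N}$, no member of which is a proper subset of another, such that every infinite $X\subseteq\bigcup B$ has a nonempty initial segment belonging to $B$. A barrier is well-ordered by the lexicographic order; its order type is the type of this well-order. A map $f$ from a barrier $B$ into a quasi-ordered set $Q$ is good if there exist $s,t\in B$ with $s\triangleleft t$ and $f(s)\leq f(t)$, and bad otherwise. $Q$ is $\alpha$-bqo if every map from a barrier of order type at most $\alpha$ into $Q$ is good. -}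

module Defs where

open import Data.List.Base using (List; []; _∷_)
open import Data.List.Membership.Propositional using (_∈_)
open import Data.List.Relation.Binary.Lex.Strict using (Lex-<)
open import Data.List.Relation.Binary.Prefix.Heterogeneous using (Prefix)
open import Data.List.Relation.Binary.Subset.Propositional using (_⊆_)
open import Data.List.Relation.Unary.All using (All)
open import Data.List.Relation.Unary.Linked using (Linked)
import Data.List.Membership.Setoid as SetoidMembership
open import Data.Nat.Base as ℕ using (ℕ)
open import Data.Product.Base using (∃; ∃-syntax; _×_; _,_; proj₁)
open import Data.Sum.Base using (_⊎_)
open import Function.Base using (_∘_; _on_)
open import Function.Bundles using (Func)
open import Function.Definitions using (Injective)
open import Induction.WellFounded using (WellFounded)
open import Level using (Level; 0ℓ; suc; _⊔_)
open import Relation.Binary.Bundles using (Setoid; Preorder; Poset; StrictTotalOrder)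
open import Relation.Binary.Core using (Rel)
open import Relation.Binary.Morphism.Structures using (IsOrderMonomorphism)
open import Relation.Binary.PropositionalEquality using (_≡_; _≢_)
open import Relation.Nullary using (¬_)
open import Relation.Unary as U using (Pred; _≐_)
import Relation.Binary.Construct.On as On
import Relation.Binary.Properties.Poset as PosetProperties
import Relation.Binary.PropositionalEquality.Properties as ≡

private variable
  c ℓ₁ ℓ₂ ℓ : Level

-- A subset of a setoid is finite when its elements all occur, up to ≈, in some
-- list.
module _ (S : Setoid c ℓ₁) where
  open Setoid S using (Carrier)
  open SetoidMembership S using () renaming (_∈_ to _∈ₗ_)

  Finite : Pred Carrier ℓ → Set (c ⊔ ℓ₁ ⊔ ℓ)
  Finite X = ∃[ xs ] (∀ x → X x → x ∈ₗ xs)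

  Infinite : Pred Carrier ℓ → Set (c ⊔ ℓ₁ ⊔ ℓ)
  Infinite X = ¬ Finite X

-- Finite subsets of ℕ are represented by their increasing enumerations, that
-- is, by the lists satisfying Increasing. Propositional equality of such lists
-- is equality of sets, and the list-membership inclusion _⊆_ is set inclusion.
Increasing : Pred (List ℕ) 0ℓ
Increasing = Linked ℕ._<_

_⊂_ : Rel (List ℕ) 0ℓ
s ⊂ t = s ⊆ t × s ≢ t

_ProperInitialSegmentOf_ : Rel (List ℕ) 0ℓ
s ProperInitialSegmentOf r = Prefix _≡_ s r × s ≢ r

-- The set r is necessarily nonempty, having a proper initial segment, so it is
-- n ∷ t with n its least element.
_◁_ : Rel (List ℕ) 0ℓ
s ◁ t = ∃[ n ] Increasing (n ∷ t) × s ProperInitialSegmentOf (n ∷ t)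

_InitialSegmentOf_ : List ℕ → Pred ℕ 0ℓ → Set
s InitialSegmentOf X =
  All X s × (∀ {x y} → X x → y ∈ s → x ℕ.< y → x ∈ s)

⋃ : Pred (List ℕ) 0ℓ → Pred ℕ 0ℓ
⋃ B n = ∃[ s ] B s × n ∈ s

record IsBarrier (B : Pred (List ℕ) 0ℓ) : Set₁ where
  field
    increasing : ∀ {s} → B s → Increasing s
    infinite   : Infinite (≡.setoid (List ℕ)) B
    antichain  : ∀ {s t} → B s → B t → ¬ (s ⊂ t)
    covering   : ∀ (X : Pred ℕ 0ℓ) → Infinite (≡.setoid ℕ) X → X U.⊆ ⋃ B →
                 ∃[ s ] B s × s ≢ [] × s InitialSegmentOf X

record Barrier : Set₁ where
  field
    Member    : Pred (List ℕ) 0ℓ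
    isBarrier : IsBarrier Member

  -- Two elements are equal when the underlying finite sets are, whatever the
  -- proofs of membership; maps out of the barrier must respect this.
  setoid : Setoid 0ℓ 0ℓ
  setoid = On.setoid {B = ∃ Member} (≡.setoid (List ℕ)) proj₁

  open Setoid setoid public using (Carrier; _≈_)

  infix 4 _<ₗₑₓ_
  _<ₗₑₓ_ : Rel Carrier 0ℓ
  _<ₗₑₓ_ = Lex-< _≡_ ℕ._<_ on proj₁

-- A countable ordinal is given by a countable (possibly finite) well-ordered
-- set.
record CountableOrdinal : Set₁ where
  field
    strictTotalOrder : StrictTotalOrder 0ℓ 0ℓ 0ℓ

  open StrictTotalOrder strictTotalOrder public

  field
    wellFounded : WellFounded _<_
    code        : Func Eq.setoid (≡.setoid ℕ)
    injective   : Injective _≈_ _≡_ (Func.to code)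

-- The lexicographic order of B is isomorphic to an initial segment of α.
record OrderTypeAtMost (α : CountableOrdinal) (B : Barrier) : Set where
  private
    module α = CountableOrdinal α
    module B = Barrier B
  field
    rank        : B.Carrier → α.Carrier
    isEmbedding : IsOrderMonomorphism B._≈_ α._≈_ B._<ₗₑₓ_ α._<_ rank
    isInitial   : ∀ {a s} → a α.< rank s → ∃[ t ] rank t α.≈ a

module _ (Q : Preorder c ℓ₁ ℓ₂) where
  open Preorder Q using (_≲_; module Eq)

  Good : (B : Barrier) → Func (Barrier.setoid B) Eq.setoid → Set ℓ₂
  Good B f = ∃[ s ] ∃[ t ] proj₁ s ◁ proj₁ t × to s ≲ to t
    where open Func f using (to)

  BQO : CountableOrdinal → Set (suc 0ℓ ⊔ c ⊔ ℓ₁ ⊔ ℓ₂)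
  BQO α = (B : Barrier) → OrderTypeAtMost α B →
          (f : Func (Barrier.setoid B) Eq.setoid) → Good B f

module _ (P : Poset c ℓ₁ ℓ₂) where
  open Poset P
  open PosetProperties P using (_<_; <-respˡ-≈; <-respʳ-≈)

  _≤pred_ _≤succ_ _≤crit_ : Rel Carrier (c ⊔ ℓ₁ ⊔ ℓ₂)
  a ≤pred b = ∀ x → x < a → x < b
  a ≤succ b = ∀ y → b < y → a < y
  a ≤crit b = a ≤pred b × a ≤succ b

  predPreorder succPreorder critPreorder : Preorder c ℓ₁ (c ⊔ ℓ₁ ⊔ ℓ₂)
  predPreorder = record
    { _≲_        = _≤pred_
    ; isPreorder = record
      { isEquivalence = isEquivalence
      ; reflexive     = λ a≈b _ → <-respʳ-≈ a≈b
      ; trans         = λ p q x → q x ∘ p x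
      }
    }
  succPreorder = record
    { _≲_        = _≤succ_
    ; isPreorder = record
      { isEquivalence = isEquivalence
      ; reflexive     = λ a≈b _ → <-respˡ-≈ (Eq.sym a≈b)
      ; trans         = λ p q y → p y ∘ q y
      }
    }
  critPreorder = record
    { _≲_        = _≤crit_
    ; isPreorder = record
      { isEquivalence = isEquivalence
      ; reflexive     = λ a≈b →
          Preorder.reflexive predPreorder a≈b , Preorder.reflexive succPreorder a≈b
      ; trans         = λ (p , p′) (q , q′) →
          Preorder.trans predPreorder p q , Preorder.trans succPreorder p′ q′
      }
    }

  -- The level is large enough for every subset of P definable from its order
  -- by quantifying over its elements.
  Subset : Set (suc (c ⊔ ℓ₁ ⊔ ℓ₂))
  Subset = Pred Carrier (c ⊔ ℓ₁ ⊔ ℓ₂)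

  IsAntichain : Subset → Set (c ⊔ ℓ₁ ⊔ ℓ₂)
  IsAntichain X = ∀ {x y} → X x → X y → ¬ (x ≈ y) → ¬ (x ≤ y ⊎ y ≤ x)

  NoInfiniteAntichain : Set (suc (c ⊔ ℓ₁ ⊔ ℓ₂))
  NoInfiniteAntichain = ∀ X → IsAntichain X → ¬ Infinite Eq.setoid X

  -- Maximality forces X to be closed under ≈, because its closure under ≈ is
  -- again an antichain.
  record MaximalAntichain : Set (suc (c ⊔ ℓ₁ ⊔ ℓ₂)) where
    field
      set         : Subset
      isAntichain : IsAntichain set
      maximal     : ∀ Y → IsAntichain Y → set U.⊆ Y → Y U.⊆ set

  open MaximalAntichain

  _⊑_ : Rel MaximalAntichain (c ⊔ ℓ₁ ⊔ ℓ₂)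
  X ⊑ Y = ∀ x → set X x → ∃[ y ] set Y y × x ≤ y

  AM : Preorder (suc (c ⊔ ℓ₁ ⊔ ℓ₂)) (c ⊔ ℓ₁ ⊔ ℓ₂) (c ⊔ ℓ₁ ⊔ ℓ₂)
  AM = record
    { Carrier    = MaximalAntichain
    ; _≈_        = λ X Y → set X ≐ set Y
    ; _≲_        = _⊑_
    ; isPreorder = record
      { isEquivalence = record
        { refl  = (λ x → x) , (λ x → x)
        ; sym   = λ (p , q) → q , p
        ; trans = λ (p , p′) (q , q′) → q ∘ p , p′ ∘ q′
        }
      ; reflexive     = λ (X⊆Y , _) x x∈X → x , X⊆Y x∈X , refl
      ; trans         = λ X⊑Y Y⊑Z x x∈X →
          let (y , y∈Y , x≤y) = X⊑Y x x∈X
              (z , z∈Z , y≤z) = Y⊑Z y y∈Y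
          in z , z∈Z , trans x≤y y≤z
      }
    }

{-# OPTIONS --safe #-}

-- Since a ≤ b implies a ≤crit b, the point is to turn a bad map f into P into bad
-- maps for ≤succ and ≤pred on a sub-barrier. If P has an infinite descending
-- sequence p, then s ↦ p (min s) is bad for ≤succ, ≤pred and AM(P). Otherwise, by
-- Nash-Williams' theorem and a fusion argument, one may assume that for each
-- initial segment u of a member either f is constant on the members extending u,
-- or f increases strictly along the members extending u whenever the rest moves to
-- the right. Cutting t just before the first segment on which f becomes constant
-- and extending what is left further to the right gives g t with f t < g t. After
-- one more application of the theorem these cuts do not decrease from s to t when
-- s ◁ t, and then f s ≰ g t. Hence f is bad for ≤succ and g is bad for ≤pred.
--
-- For AM(P), a failure of f s ≤ f t is witnessed by an element of the finite set
-- f s, and fusion makes this element independent of t, which gives a bad map into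
-- P. Conversely, if P is well-founded then a ↦ {a} ∪ {minimal elements incomparable
-- to a} reflects ≤pred. As ∃ is a Σ-type, excluded middle provides the choices.

module Submission where

open import Defs
open import Axiom.ExcludedMiddle using (ExcludedMiddle)
open import Data.Empty using (⊥; ⊥-elim)
open import Data.Fin.Base as Fin using (Fin)
open import Data.Fin.Properties using (pigeonhole)
open import Data.List.Base as List using (List; []; _∷_; _++_; _∷ʳ_; length; take; drop)
open import Data.List.Membership.Propositional using (_∈_; find; lose)
open import Data.List.Membership.Propositional.Properties
  using (∈-++⁺ˡ; ∈-++⁺ʳ; ∈-map⁺; ∈-concat⁺′)
open import Data.List.Properties
  using (++-assoc; ++-identityʳ; ++-identityʳ-unique; ++-conicalˡ; ∷-injectiveˡ; ∷-injectiveʳ;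
         length-++; length-++-≤ˡ; take++drop≡id; take-all)
import Data.List.Relation.Binary.Lex.Strict as Lex
open import Data.List.Relation.Binary.Pointwise using (Pointwise-≡⇒≡)
open import Data.List.Relation.Binary.Prefix.Heterogeneous using (Prefix; []; _∷_)
open import Data.List.Relation.Binary.Subset.Propositional using (_⊆_)
open import Data.List.Relation.Binary.Subset.Propositional.Properties using (∷⁺ʳ)
open import Data.List.Relation.Unary.All as All using (All; []; _∷_)
open import Data.List.Relation.Unary.All.Properties using (anti-mono; ++⁺; ++⁻; take⁺; drop⁺)
open import Data.List.Relation.Unary.AllPairs using (AllPairs; []; _∷_)
open import Data.List.Relation.Unary.Any as Any using (Any; here; there)
open import Data.List.Relation.Unary.Any.Properties using (lookup-index)
open import Data.List.Relation.Unary.Linked as Linked using ([]; [-]; _∷_)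
open import Data.List.Relation.Unary.Linked.Properties using (Linked⇒AllPairs)
open import Data.Nat.Base as ℕ using (ℕ; zero; suc; z≤n; s≤s; _≤′_; ≤′-refl; ≤′-step)
open import Data.Nat.Induction using (<-wellFounded)
import Data.Nat.Properties as ℕ
open import Data.Product using (Σ; ∃; ∃-syntax; _×_; _,_; proj₁; proj₂)
open import Data.Sum as Sum using (_⊎_; inj₁; inj₂; [_,_]; [_,_]′)
open import Data.Unit.Polymorphic using (⊤; tt)
open import Function.Base using (_∘_; id; case_of_)
open import Function.Bundles using (_⇔_; Func; mk⇔)
open import Induction.WellFounded using (WellFounded; Acc; acc)
open import Level using (Level; 0ℓ; _⊔_; Lift; lift)
open import Relation.Binary.Bundles using (Poset; Preorder)
open import Relation.Binary.Core using (Rel)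
open import Relation.Binary.Definitions using (tri<; tri≈; tri>)
open import Relation.Binary.Morphism.Structures using (IsOrderMonomorphism)
import Relation.Binary.Properties.Poset as PosetProperties
open import Relation.Binary.PropositionalEquality
  using (_≡_; _≢_; refl; sym; trans; cong; subst)
import Relation.Binary.PropositionalEquality.Properties as ≡
open import Relation.Nullary using (¬_; yes; no; contradiction)
open import Relation.Nullary.Decidable using (True; toWitness; fromWitness; decidable-stable)
open import Relation.Unary using (Pred) renaming (_⊆_ to _⊆′_)

private variable
  a ℓ : Level
  A : Set a
  m n k : ℕ
  s t u w r : List ℕ
  X Y Z : Pred ℕ 0ℓ
  𝓕 𝓖 : Pred (List ℕ) 0ℓ
  𝓢 : List ℕ → Pred (List ℕ) 0ℓ

-- Increasing lists

increasing-head : Increasing (n ∷ s) → All (n ℕ.<_) s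
increasing-head inc with Linked⇒AllPairs ℕ.<-trans inc
... | p ∷ _ = p

increasing-∷ : All (n ℕ.<_) s → Increasing s → Increasing (n ∷ s)
increasing-∷ {s = []}    _       _   = [-]
increasing-∷ {s = _ ∷ _} (p ∷ _) inc = p ∷ inc

increasing-++ˡ : ∀ s → Increasing (s ++ r) → Increasing s
increasing-++ˡ []          _         = []
increasing-++ˡ (_ ∷ [])    _         = [-]
increasing-++ˡ (_ ∷ _ ∷ s) (p ∷ inc) = p ∷ increasing-++ˡ (_ ∷ s) inc

increasing-≪ : ∀ s → Increasing (s ++ r) → All (λ x → All (ℕ._< x) s) r
increasing-≪ []      _   = All.universal (λ _ → []) _
increasing-≪ (_ ∷ s) inc =
  All.zipWith (λ (p , q) → p ∷ q)
    (proj₂ (++⁻ s (increasing-head inc)) , increasing-≪ s (Linked.tail inc))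

increasing-length : k ℕ.≤ n → Increasing s → All (k ℕ.≤_) s → All (ℕ._< n) s →
                    length s ℕ.+ k ℕ.≤ n
increasing-length k≤n _ [] [] = k≤n
increasing-length {s = x ∷ s} k≤n inc (k≤x ∷ _) (x<n ∷ s<n) =
  ℕ.≤-trans (s≤s (ℕ.+-monoʳ-≤ (length s) k≤x))
    (ℕ.≤-trans (ℕ.≤-reflexive (sym (ℕ.+-suc (length s) x)))
      (increasing-length x<n (Linked.tail inc) (increasing-head inc) s<n))

-- All subsets of the interval from `k` up to but excluding `k + n`. Each stage of the fusion thus
-- meets only finitely many requirements.
increasingWithin : ℕ → ℕ → List (List ℕ)
increasingWithin k zero    = [] ∷ []
increasingWithin k (suc n) =
  increasingWithin (suc k) n ++ List.map (k ∷_) (increasingWithin (suc k) n)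

∈-increasingWithin : ∀ n → Increasing s → All (k ℕ.≤_) s → All (ℕ._< n ℕ.+ k) s →
                     s ∈ increasingWithin k n
∈-increasingWithin zero _ [] [] = here refl
∈-increasingWithin zero _ (k≤x ∷ _) (x<k ∷ _) = contradiction k≤x (ℕ.<⇒≱ x<k)
∈-increasingWithin (suc n) _ [] [] = ∈-++⁺ˡ (∈-increasingWithin n [] [] [])
∈-increasingWithin {s = x ∷ s} {k = k} (suc n) inc (k≤x ∷ _) below
  with All.map (λ {y} p → subst (y ℕ.<_) (sym (ℕ.+-suc n k)) p) below | ℕ.m≤n⇒m<n∨m≡n k≤x
... | below′ | inj₁ k<x =
  ∈-++⁺ˡ (∈-increasingWithin n inc
    (k<x ∷ All.map (λ x<y → ℕ.<-trans k<x x<y) (increasing-head inc)) below′)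
... | _ ∷ below′ | inj₂ refl =
  ∈-++⁺ʳ (increasingWithin (suc k) n)
    (∈-map⁺ (k ∷_) (∈-increasingWithin n (Linked.tail inc) (increasing-head inc) below′))

increasingBelow : ℕ → List (List ℕ)
increasingBelow = increasingWithin 0

∈-increasingBelow : Increasing s → All (ℕ._< n) s → s ∈ increasingBelow n
∈-increasingBelow {n = n} inc below =
  ∈-increasingWithin n inc (All.universal (λ _ → z≤n) _)
    (All.map (λ {y} → subst (y ℕ.<_) (sym (ℕ.+-identityʳ n))) below)

upperBound : ∀ s → ∃[ n ] All (ℕ._< n) s
upperBound []      = 0 , []
upperBound (x ∷ s) with upperBound s
... | n , p = suc x ℕ.⊔ n , ℕ.m≤m⊔n (suc x) n ∷ All.map (λ q → ℕ.m≤n⇒m≤o⊔n (suc x) q) p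

-- Infinite subsets of ℕ and Nash-Williams' theorem

Unbounded : Pred (Pred ℕ 0ℓ) 0ℓ
Unbounded X = ∀ n → ∃[ m ] n ℕ.≤ m × X m

-- Usually written X/s.
infix 5 _beyond_
_beyond_ : Pred ℕ 0ℓ → List ℕ → Pred ℕ 0ℓ
(X beyond s) x = X x × All (ℕ._< x) s

beyond-unbounded : ∀ s → Unbounded X → Unbounded (X beyond s)
beyond-unbounded s ub n with upperBound s
... | k , s<k with ub (n ℕ.⊔ k)
...   | m , le , x = m , ℕ.m⊔n≤o⇒m≤o n k le , x ,
  All.map (λ p → ℕ.<-≤-trans p (ℕ.m⊔n≤o⇒n≤o n k le)) s<k

-- Initial segments and the relation `◁`

Prefix⇒++ : Prefix _≡_ s t → ∃[ c ] t ≡ s ++ c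
Prefix⇒++ []         = _ , refl
Prefix⇒++ (refl ∷ p) with Prefix⇒++ p
... | c , refl = c , refl

++⇒Prefix : ∀ s → Prefix _≡_ s (s ++ r)
++⇒Prefix []      = []
++⇒Prefix (_ ∷ s) = refl ∷ ++⇒Prefix s

prefixes-comparable : ∀ (s t : List ℕ) {c d} → s ++ c ≡ t ++ d →
                      (∃[ e ] s ≡ t ++ e) ⊎ (∃[ e ] t ≡ s ++ e)
prefixes-comparable []      t       _  = inj₂ (t , refl)
prefixes-comparable (x ∷ s) []      _  = inj₁ (x ∷ s , refl)
prefixes-comparable (x ∷ s) (y ∷ t) eq
  with refl ← ∷-injectiveˡ eq | prefixes-comparable s t (∷-injectiveʳ eq)
... | inj₁ (e , refl) = inj₁ (e , refl)
... | inj₂ (e , refl) = inj₂ (e , refl)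

-- Writing `t` as `drop 1 s ++ c` with `c` beyond `s` turns a statement about `s ◁ t` into one about
-- pairs, to which the partition theorem for pairs applies.
◁-tail : s ≢ [] → s ◁ t → ∃[ c ] t ≡ drop 1 s ++ c × All (λ x → All (ℕ._< x) s) c
◁-tail {s = []}    s≢[] _ = contradiction refl s≢[]
◁-tail {s = n ∷ s} _ (_ , inc , refl ∷ p , _) with Prefix⇒++ p
... | c , refl = c , refl , increasing-≪ (n ∷ s) inc

-- If `y` is not `x`, it is larger, being a later entry of `w` or an element of `Z`. Closure then
-- puts `x` into `y ∷ s`, whose entries are all at least `y`.
heads-agree : ∀ {x y} → Increasing (x ∷ w) → Increasing (y ∷ s) →
  Z ⊆′ (λ z → All (ℕ._< z) (x ∷ w)) → y ∈ x ∷ w ⊎ Z y →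
  (∀ {u v} → u ∈ x ∷ w → v ∈ y ∷ s → u ℕ.< v → u ∈ y ∷ s) → x ≡ y
heads-agree {w = w} {s = s} {Z = Z} {x} {y} incʷ incˢ Z≫w y∈ closed = go y∈
  where
  x≮y : x ℕ.< y → x ≡ y
  x≮y x<y with closed (here refl) (here refl) x<y
  ... | here x≡y  = x≡y
  ... | there x∈s = contradiction x<y (ℕ.<-asym (All.lookup (increasing-head incˢ) x∈s))

  go : y ∈ x ∷ w ⊎ Z y → x ≡ y
  go (inj₁ (here y≡x))  = sym y≡x
  go (inj₁ (there y∈w)) = x≮y (All.lookup (increasing-head incʷ) y∈w)
  go (inj₂ Zy)          = x≮y (All.head (Z≫w Zy))

-- An initial segment of the union of `w` and `Z`, with `Z` beyond `w`, stops within `w` or contains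
-- all of it: the heads agree, and the tails are in the same situation.
initial-segment-split : ∀ w s → Increasing w → Increasing s → Z ⊆′ (λ z → All (ℕ._< z) w) →
  All (λ x → x ∈ w ⊎ Z x) s → (∀ {x y} → x ∈ w → y ∈ s → x ℕ.< y → x ∈ s) →
  (∃[ c ] w ≡ s ++ c) ⊎ (∃[ r ] s ≡ w ++ r × All Z r)
initial-segment-split [] s _ _ _ s⊆ _ = inj₂ (s , refl , All.map [ (λ ()) , id ] s⊆)
initial-segment-split (x ∷ w) [] _ _ _ _ _ = inj₁ (x ∷ w , refl)
initial-segment-split {Z = Z} (x ∷ w) (y ∷ s) incʷ incˢ Z≫w (y∈ ∷ s⊆) closed
  with refl ← heads-agree incʷ incˢ Z≫w y∈ closed =
  Sum.map (λ { (c , refl) → c , refl }) (λ { (r , refl , Zr) → r , refl , Zr })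
    (initial-segment-split w s (Linked.tail incʷ) (Linked.tail incˢ) (All.tail ∘ Z≫w)
      (All.zipWith shrink (increasing-head incˢ , s⊆)) closed′)
  where
  shrink : ∀ {z} → x ℕ.< z × (z ∈ x ∷ w ⊎ Z z) → z ∈ w ⊎ Z z
  shrink (_   , inj₂ Zz)          = inj₂ Zz
  shrink (_   , inj₁ (there z∈w)) = inj₁ z∈w
  shrink (x<z , inj₁ (here refl)) = contradiction x<z (ℕ.<-irrefl refl)

  closed′ : ∀ {u v} → u ∈ w → v ∈ s → u ℕ.< v → u ∈ s
  closed′ u∈w v∈s u<v with closed (there u∈w) (there v∈s) u<v
  ... | there u∈s = u∈s
  ... | here refl = contradiction (All.lookup (increasing-head incʷ) u∈w) (ℕ.<-irrefl refl)

take-++-prefix : ∀ {j k} (s : List ℕ) {c} → j ℕ.≤ k → j ℕ.≤ length s →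
                 ∃[ d ] take k (s ++ c) ≡ take j s ++ d
take-++-prefix {zero}  s       _       _         = _ , refl
take-++-prefix {suc j} (x ∷ s) (s≤s p) (s≤s q) with take-++-prefix s p q
... | d , eq = d , cong (x ∷_) eq

first : List ℕ → ℕ
first []      = 0
first (n ∷ _) = n

◁-first : s ≢ [] → t ≢ [] → s ◁ t → first s ℕ.< first t
◁-first {s = []}                s≢[] _    _                        = contradiction refl s≢[]
◁-first {s = _ ∷ _} {t = []}    _    t≢[] _                        = contradiction refl t≢[]
◁-first {s = _ ∷ _} {t = _ ∷ _} _    _    (_ , n<m ∷ _ , refl ∷ _ , _) = n<m

-- Thin families and bar induction

IsThin : Pred (Pred (List ℕ) 0ℓ) 0ℓ
IsThin 𝓕 = (∀ {s} → 𝓕 s → Increasing s) × (∀ {s t} → 𝓕 s → 𝓕 t → s ⊆ t → s ≡ t)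

thin-∷ : IsThin 𝓕 → ∀ n → IsThin (𝓕 ∘ (n ∷_))
thin-∷ (inc , anti) n =
  (λ p → Linked.tail (inc p)) , λ p q s⊆t → ∷-injectiveʳ (anti p q (∷⁺ʳ n s⊆t))

thin-++ : IsThin 𝓕 → ∀ u → IsThin (𝓕 ∘ (u ++_))
thin-++ thin []      = thin
thin-++ thin (n ∷ u) = thin-++ (thin-∷ thin n) u

-- 𝓕 ∘ (n ∷_) consists of the members of 𝓕 starting with n, so induction on Bar 𝓕
-- is bar induction over the tree of initial segments of members of 𝓕.
data Bar (𝓕 : Pred (List ℕ) 0ℓ) : Set where
  stop : (∀ {r} → 𝓕 r → r ≡ []) → Bar 𝓕
  node : (∀ n → Bar (𝓕 ∘ (n ∷_))) → Bar 𝓕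

bar-antitone : (∀ {r} → 𝓖 r → 𝓕 r) → Bar 𝓕 → Bar 𝓖
bar-antitone 𝓖⊆𝓕 (stop h) = stop (h ∘ 𝓖⊆𝓕)
bar-antitone 𝓖⊆𝓕 (node h) = node (λ n → bar-antitone 𝓖⊆𝓕 (h n))

bar-∷ : Bar 𝓕 → ∀ n → Bar (𝓕 ∘ (n ∷_))
bar-∷ (stop h) n = stop (λ p → contradiction (h p) λ ())
bar-∷ (node h) n = h n

bar-++ : Bar 𝓕 → ∀ u → Bar (𝓕 ∘ (u ++_))
bar-++ bar []      = bar
bar-++ bar (n ∷ u) = bar-++ (bar-∷ bar n) u

≤-induction : (_≼_ : ℕ → ℕ → Set a) → (∀ {i} → i ≼ i) →
              (∀ {i j} → i ≼ j → i ≼ suc j) → m ℕ.≤ n → m ≼ n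
≤-induction _≼_ rfl step m≤n = go (ℕ.≤⇒≤′ m≤n)
  where
  go : ∀ {i j} → i ≤′ j → i ≼ j
  go ≤′-refl     = rfl
  go (≤′-step p) = step (go p)

module _ (em : ∀ {ℓ} → ExcludedMiddle ℓ) where

  by-contradiction : {P : Set ℓ} → ¬ ¬ P → P
  by-contradiction = decidable-stable em

  counterexample : {P : A → Set ℓ} → ¬ (∀ x → P x) → ∃[ x ] ¬ P x
  counterexample ¬all = by-contradiction λ none → ¬all λ x → by-contradiction λ ¬p → none (x , ¬p)

  abstract
    minimal : {_<_ : Rel A a} (Q : Pred A ℓ) → ∀ {x} → Acc _<_ x → Q x →
              ∃[ y ] Q y × (∀ z → z < y → ¬ Q z)
    minimal {_<_ = _<_} Q {x} (acc rs) q with em {P = ∃[ z ] z < x × Q z}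
    ... | yes (z , z<x , q′) = minimal Q (rs z<x) q′
    ... | no none            = x , q , λ z z<x q′ → none (z , z<x , q′)

  unbounded⇒infinite : Unbounded X → Infinite (≡.setoid ℕ) X
  unbounded⇒infinite ub (xs , h) with upperBound xs
  ... | n , xs<n with ub n
  ...   | x , n≤x , Xx = ℕ.<⇒≱ (All.lookup xs<n (h x Xx)) n≤x

  -- em replaces the membership proofs of G by booleans, which keeps Z in Pred ℕ 0ℓ.
  abstract
    split-unbounded : (G : Pred ℕ ℓ) → Unbounded X →
      ∃[ Z ] Unbounded Z × Z ⊆′ X × ((∀ {x} → Z x → G x) ⊎ (∀ {x} → Z x → ¬ G x))
    split-unbounded {X = X} G ub with em {P = Unbounded (λ x → X x × True (em {P = G x}))}
    ... | yes ub′ = _ , ub′ , proj₁ , inj₁ (λ (_ , p) → toWitness p)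
    ... | no ¬ub′ with counterexample ¬ub′
    ...   | n , none = (λ x → X x × n ℕ.≤ x) ,
      (λ k → let (x , le , Xx) = ub (k ℕ.⊔ n)
             in x , ℕ.m⊔n≤o⇒m≤o k n le , Xx , ℕ.m⊔n≤o⇒n≤o k n le) ,
      proj₁ , inj₂ (λ (Xx , n≤x) p → none (_ , n≤x , Xx , fromWitness p))

  -- Fusion

  module _ (H : List ℕ → Pred ℕ 0ℓ → Set ℓ)
           (hereditary : ∀ s {Y Z} → Z ⊆′ Y → H s Y → H s Z)
           (refine : ∀ s {Y} → Unbounded Y → ∃[ Z ] Unbounded Z × Z ⊆′ Y × H s Z) where

    private
      refineAll : ∀ ss → Unbounded Y → ∃[ Z ] Unbounded Z × Z ⊆′ Y × All (λ s → H s Z) ss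
      refineAll []       ub = _ , ub , id , []
      refineAll (s ∷ ss) ub with refineAll ss ub
      ... | Z , ubZ , Z⊆Y , hs with refine s ubZ
      ...   | W , ubW , W⊆Z , h = W , ubW , Z⊆Y ∘ W⊆Z , h ∷ All.map (hereditary _ W⊆Z) hs

      -- The reservoir is to satisfy `H s` for every increasing `s` below the bound; the point is
      -- the next element of the fused set.
      record Stage : Set₁ where
        field
          bound     : ℕ
          reservoir : Pred ℕ 0ℓ
          unbounded : Unbounded reservoir

        point : ℕ
        point = proj₁ (unbounded bound)

      open Stage

      fromBound : ℕ → Unbounded Y → Stage
      fromBound n ub = record
        { bound = n ; unbounded = proj₁ (proj₂ (refineAll (increasingBelow n) ub)) }

      stage : Unbounded Y → ℕ → Stage
      stage ub zero    = fromBound 0 ub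
      -- The bound passes the latest point, so lists containing it are treated before the next point
      -- is chosen.
      stage ub (suc i) = fromBound (suc (point (stage ub i))) (unbounded (stage ub i))

      module Fusion {Y} (ub : Unbounded Y) where
        σ : ℕ → Stage
        σ = stage ub

        bound≤point : ∀ i → bound (σ i) ℕ.≤ point (σ i)
        bound≤point i = proj₁ (proj₂ (unbounded (σ i) (bound (σ i))))

        point∈ : ∀ i → reservoir (σ i) (point (σ i))
        point∈ i = proj₂ (proj₂ (unbounded (σ i) (bound (σ i))))

        reservoir-antitone : ∀ {m n} → m ℕ.≤ n → reservoir (σ n) ⊆′ reservoir (σ m)
        reservoir-antitone = ≤-induction (λ i j → reservoir (σ j) ⊆′ reservoir (σ i)) id
          λ {_} {j} ih → ih ∘ proj₁ (proj₂ (proj₂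
            (refineAll (increasingBelow (suc (point (σ j)))) (unbounded (σ j)))))

        reservoir⊆ : reservoir (σ 0) ⊆′ Y
        reservoir⊆ = proj₁ (proj₂ (proj₂ (refineAll (increasingBelow 0) ub)))

        bound-monotone : m ℕ.≤ n → bound (σ m) ℕ.≤ bound (σ n)
        bound-monotone = ≤-induction (λ i j → bound (σ i) ℕ.≤ bound (σ j)) ℕ.≤-refl
          λ {_} {j} ih → ℕ.≤-trans ih (ℕ.m≤n⇒m≤1+n (bound≤point j))

        n≤bound : ∀ n → n ℕ.≤ bound (σ n)
        n≤bound zero    = z≤n
        n≤bound (suc n) = s≤s (ℕ.≤-trans (n≤bound n) (bound≤point n))

        treated : ∀ i {s} → Increasing s → All (ℕ._< bound (σ i)) s → H s (reservoir (σ i))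
        treated zero    inc below =
          All.lookup (proj₂ (proj₂ (proj₂ (refineAll _ ub)))) (∈-increasingBelow inc below)
        treated (suc i) inc below =
          All.lookup (proj₂ (proj₂ (proj₂ (refineAll _ (unbounded (σ i))))))
            (∈-increasingBelow inc below)

        Points : Pred ℕ 0ℓ
        Points x = ∃[ i ] point (σ i) ≡ x

        points-unbounded : Unbounded Points
        points-unbounded n = point (σ n) , ℕ.≤-trans (n≤bound n) (bound≤point n) , n , refl

        points⊆Y : Points ⊆′ Y
        points⊆Y (i , refl) = reservoir⊆ (reservoir-antitone {0} {i} z≤n (point∈ i))

        later : ∀ {i j} → point (σ i) ℕ.< point (σ j) → reservoir (σ (suc i)) (point (σ j))
        later {i} {j} lt with ℕ.<-≤-connex i j
        ... | inj₁ i<j = reservoir-antitone {suc i} {j} i<j (point∈ j)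
        ... | inj₂ j≤i = contradiction lt (ℕ.≤⇒≯ (ℕ.s≤s⁻¹ (bound-monotone (s≤s j≤i))))

        -- The stage just after the largest entry of `s` was chosen; all larger points are drawn
        -- from its reservoir.
        locate : ∀ {s} → All Points s →
                 ∃[ i ] All (ℕ._< bound (σ i)) s × (Points beyond s) ⊆′ reservoir (σ i)
        locate []               = 0 , [] , λ ((j , eq) , _) →
          subst (reservoir (σ 0)) eq (reservoir-antitone {0} {j} z≤n (point∈ j))
        locate ((j , refl) ∷ Ps) with locate Ps
        ... | i , below , sub with ℕ.<-≤-connex j i
        ...   | inj₁ j<i = i , bound-monotone j<i ∷ below , λ { (Px , _ ∷ p) → sub (Px , p) }
        ...   | inj₂ i≤j = suc j ,
          ℕ.≤-refl ∷ All.map (λ p → ℕ.<-≤-trans p (bound-monotone (ℕ.m≤n⇒m≤1+n i≤j))) below ,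
          λ { ((l , refl) , p ∷ _) → later {j} {l} p }

    abstract
      -- The set of points chosen at successive stages works: `s` is treated at the stage found by
      -- `locate`, and `H s` passes down from its reservoir to the points beyond `s`.
      diagonal : Unbounded Y → ∃[ X ] Unbounded X × X ⊆′ Y ×
                 (∀ {s} → Increasing s → All X s → H s (X beyond s))
      diagonal ub = Points , points-unbounded , points⊆Y , λ inc Xs →
        let (i , below , sub) = locate Xs in hereditary _ sub (treated i inc below)
        where open Fusion ub

  -- Partition theorems

  Homogeneous : Pred (List ℕ) 0ℓ → Pred (List ℕ) ℓ → Pred ℕ 0ℓ → Set ℓ
  Homogeneous 𝓕 C Z = (∀ {r} → 𝓕 r → All Z r → C r) ⊎ (∀ {r} → 𝓕 r → All Z r → ¬ C r)

  homogeneous-antitone : {C : Pred (List ℕ) ℓ} → Z ⊆′ Y → Homogeneous 𝓕 C Y → Homogeneous 𝓕 C Z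
  homogeneous-antitone Z⊆Y (inj₁ h) = inj₁ (λ p Zr → h p (All.map Z⊆Y Zr))
  homogeneous-antitone Z⊆Y (inj₂ h) = inj₂ (λ p Zr → h p (All.map Z⊆Y Zr))

  abstract
    -- By induction on the bar, fusion makes every section at `n` homogeneous beyond `n`, with a
    -- colour depending on `n`. Splitting the `n` by colour then gives one colour.
    nash-williams : IsThin 𝓕 → Bar 𝓕 → (C : Pred (List ℕ) ℓ) → Unbounded Y →
                    ∃[ Z ] Unbounded Z × Z ⊆′ Y × Homogeneous 𝓕 C Z
    nash-williams {𝓕 = 𝓕} thin bar C ub with em {P = 𝓕 []}
    -- Thinness makes `[]` the only member.
    nash-williams {𝓕 = 𝓕} thin bar C ub | yes 𝓕[] with em {P = C []}
    ... | yes c = _ , ub , id , inj₁ λ p _ → subst C (proj₂ thin 𝓕[] p λ ()) c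
    ... | no ¬c = _ , ub , id , inj₂ λ p _ → subst (¬_ ∘ C) (proj₂ thin 𝓕[] p λ ()) ¬c
    nash-williams {𝓕 = 𝓕} thin (stop h) C ub | no ¬𝓕[] =
      _ , ub , id , inj₁ λ p _ → contradiction (subst 𝓕 (h p) p) ¬𝓕[]
    nash-williams {𝓕 = 𝓕} {ℓ = ℓ} thin (node h) C ub | no ¬𝓕[]
      with diagonal H hereditary refine ub
      where
      -- Only one-element lists carry a requirement, namely on the section at `n`.
      H : List ℕ → Pred ℕ 0ℓ → Set ℓ
      H (n ∷ []) Z = Homogeneous (𝓕 ∘ (n ∷_)) (C ∘ (n ∷_)) Z
      H _        Z = ⊤

      hereditary : ∀ s {Y Z} → Z ⊆′ Y → H s Y → H s Z
      hereditary []          _   _  = tt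
      hereditary (_ ∷ [])    Z⊆Y hm = homogeneous-antitone Z⊆Y hm
      hereditary (_ ∷ _ ∷ _) _   _  = tt

      refine : ∀ s {Y} → Unbounded Y → ∃[ Z ] Unbounded Z × Z ⊆′ Y × H s Z
      refine []          ub = _ , ub , id , tt
      refine (n ∷ [])    ub = nash-williams (thin-∷ thin n) (h n) (C ∘ (n ∷_)) ub
      refine (_ ∷ _ ∷ _) ub = _ , ub , id , tt
    ... | X , ubX , X⊆Y , hX
      with split-unbounded (λ n → ∀ r → 𝓕 (n ∷ r) → All (X beyond (n ∷ [])) r → C (n ∷ r)) ubX
    ...   | Z , ubZ , Z⊆X , colour = Z , ubZ , X⊆Y ∘ Z⊆X , homogeneous colour
      where
      Above : ℕ → Set ℓ
      Above n = ∀ r → 𝓕 (n ∷ r) → All (X beyond (n ∷ [])) r → C (n ∷ r)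

      tail-beyond : ∀ {n r} → 𝓕 (n ∷ r) → All Z r → All (X beyond (n ∷ [])) r
      tail-beyond p Zr =
        All.zipWith (λ (z , n<x) → Z⊆X z , n<x ∷ []) (Zr , increasing-head (proj₁ thin p))

      homogeneous : (∀ {n} → Z n → Above n) ⊎ (∀ {n} → Z n → ¬ Above n) → Homogeneous 𝓕 C Z
      homogeneous (inj₁ all) = inj₁ λ
        { {[]}    p _         → contradiction p ¬𝓕[]
        ; {n ∷ r} p (Zn ∷ Zr) → all Zn r p (tail-beyond p Zr) }
      homogeneous (inj₂ none) = inj₂ λ
        { {[]}    p _         → contradiction p ¬𝓕[]
        ; {n ∷ r} p (Zn ∷ Zr) → case hX [-] (Z⊆X Zn ∷ []) of λ
          { (inj₁ h₁) → contradiction (λ _ → h₁) (none Zn)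
          ; (inj₂ h₂) → h₂ p (tail-beyond p Zr) } }

  abstract
    -- A colour that fails throughout some `Z` is removed, and the remaining ones still cover. The
    -- colour list is nonempty so that there is an answer even if no member lies inside `Y`.
    nash-williams-finite : IsThin 𝓕 → Bar 𝓕 → ∀ x xs (C : A → Pred (List ℕ) ℓ) → Unbounded Y →
      (∀ {r} → 𝓕 r → All Y r → Any (λ y → C y r) (x ∷ xs)) →
      ∃[ Z ] Unbounded Z × Z ⊆′ Y × ∃[ y ] (∀ {r} → 𝓕 r → All Z r → C y r)
    nash-williams-finite thin bar x [] C ub h =
      _ , ub , id , x , λ p Yr → case h p Yr of λ { (here c) → c }
    nash-williams-finite thin bar x (x′ ∷ xs) C ub h with nash-williams thin bar (C x) ub
    ... | Z , ubZ , Z⊆Y , inj₁ all = Z , ubZ , Z⊆Y , x , all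
    ... | Z , ubZ , Z⊆Y , inj₂ none
      with nash-williams-finite thin bar x′ xs C ubZ (λ p Zr →
             case h p (All.map Z⊆Y Zr) of λ
               { (here c)  → contradiction c (none p Zr)
               ; (there c) → c })
    ...   | W , ubW , W⊆Z , c = W , ubW , Z⊆Y ∘ W⊆Z , c

  Pairs : Pred (List ℕ) 0ℓ → (List ℕ → Pred (List ℕ) 0ℓ) → Pred ℕ 0ℓ →
          (List ℕ → List ℕ → Set ℓ) → Set ℓ
  Pairs 𝓕 𝓖 Z R = ∀ s r → 𝓕 s → 𝓖 s r → All Z s → All (Z beyond s) r → R s r

  abstract
    -- Fusion makes `R s` homogeneous beyond each `s`; the one-variable theorem is then applied to
    -- the resulting colour of `s`.
    nash-williams-pairs : IsThin 𝓕 → Bar 𝓕 → (∀ s → IsThin (𝓢 s)) → (∀ s → Bar (𝓢 s)) →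
      (R : List ℕ → List ℕ → Set ℓ) → Unbounded Y →
      ∃[ Z ] Unbounded Z × Z ⊆′ Y × (Pairs 𝓕 𝓢 Z R ⊎ Pairs 𝓕 𝓢 Z (λ s r → ¬ R s r))
    nash-williams-pairs {𝓕 = 𝓕} {𝓢 = 𝓢} {ℓ = ℓ} thin bar thins bars R ub
      with diagonal (λ s → Homogeneous (𝓢 s) (R s)) (λ _ → homogeneous-antitone)
             (λ s → nash-williams (thins s) (bars s) (R s)) ub
    ... | X , ubX , X⊆Y , hX
      with nash-williams thin bar (λ s → ∀ r → 𝓢 s r → All (X beyond s) r → R s r) ubX
    ...   | Z , ubZ , Z⊆X , colour = Z , ubZ , X⊆Y ∘ Z⊆X , pairs colour
      where
      Full : List ℕ → Set ℓ
      Full s = ∀ r → 𝓢 s r → All (X beyond s) r → R s r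

      pairs : (∀ {s} → 𝓕 s → All Z s → Full s) ⊎ (∀ {s} → 𝓕 s → All Z s → ¬ Full s) →
              Pairs 𝓕 𝓢 Z R ⊎ Pairs 𝓕 𝓢 Z (λ s r → ¬ R s r)
      pairs (inj₁ all)  = inj₁ λ s r p q Zs Zr → all p Zs r q (All.map (λ (z , lt) → Z⊆X z , lt) Zr)
      pairs (inj₂ none) = inj₂ λ s r p q Zs Zr → case hX (proj₁ thin p) (All.map Z⊆X Zs) of λ
        { (inj₁ h₁) → contradiction (λ _ → h₁) (none p Zs)
        ; (inj₂ h₂) → h₂ q (All.map (λ (z , lt) → Z⊆X z , lt) Zr) }

  -- Barriers and their order types

  module BarrierProperties (𝔅 : Barrier) where
    open Barrier 𝔅 using (isBarrier) renaming (Member to B)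
    open IsBarrier isBarrier

    thin : IsThin B
    thin = increasing , λ p q s⊆t → by-contradiction λ s≢t → antichain p q (s⊆t , s≢t)

    thin-prefix : B s → B (s ++ r) → r ≡ []
    thin-prefix {s} p q = ++-identityʳ-unique s (proj₂ thin p q ∈-++⁺ˡ)

    nonempty : B s → s ≢ []
    nonempty p refl = infinite ([] ∷ [] , λ t q → here (sym (proj₂ thin p q λ ())))

    ⋃-unbounded : Unbounded (⋃ B)
    ⋃-unbounded n = by-contradiction λ none → infinite
      (increasingBelow n , λ s p → ∈-increasingBelow (increasing p)
        (All.tabulate λ x∈s → ℕ.≰⇒> λ n≤x → none (_ , n≤x , s , p , x∈s)))

    private
      module Path (¬bar : ¬ Bar B) where
        next : ∀ w → ¬ Bar (B ∘ (w ++_)) → ∃[ n ] ¬ Bar (B ∘ ((w ∷ʳ n) ++_))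
        next w ¬b with counterexample (¬b ∘ node)
        ... | n , ¬b′ = n , ¬b′ ∘ bar-antitone λ {r} → subst B (sym (++-assoc w (n ∷ []) r))

        path : ℕ → ∃[ w ] ¬ Bar (B ∘ (w ++_))
        path zero    = [] , ¬bar
        path (suc i) with path i
        ... | w , ¬b with next w ¬b
        ...   | n , ¬b′ = w ∷ʳ n , ¬b′

        vertex : ℕ → List ℕ
        vertex i = proj₁ (path i)

        leaf : ∀ i → ∃[ r ] B (vertex i ++ r)
        leaf i = by-contradiction λ none →
          proj₂ (path i) (stop λ p → contradiction (_ , p) none)

        length-vertex : ∀ i → length (vertex i) ≡ i
        length-vertex zero    = refl
        length-vertex (suc i) = trans (length-++ (vertex i))
          (trans (ℕ.+-comm _ 1) (cong suc (length-vertex i)))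

        vertex-⊆ : ∀ {i j} → i ℕ.≤ j → vertex i ⊆ vertex j
        vertex-⊆ = ≤-induction (λ i j → vertex i ⊆ vertex j) id (λ ih x∈ → ∈-++⁺ˡ (ih x∈))

        Branch : Pred ℕ 0ℓ
        Branch x = ∃[ i ] x ∈ vertex i

        -- Otherwise, for some `n`, the vertex of length `n + 1` would be an increasing list of
        -- numbers below `n`.
        branch-unbounded : Unbounded Branch
        branch-unbounded n = by-contradiction λ none → ℕ.1+n≰n (ℕ.≤-trans
          (ℕ.≤-reflexive (trans (sym (length-vertex (suc n))) (sym (ℕ.+-identityʳ _))))
          (increasing-length z≤n
            (increasing-++ˡ (vertex (suc n)) (increasing (proj₂ (leaf (suc n)))))
            (All.universal (λ _ → z≤n) _)
            (All.tabulate λ x∈ → ℕ.≰⇒> λ n≤x → none (_ , n≤x , suc n , x∈))))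

        branch⊆⋃ : Branch ⊆′ ⋃ B
        branch⊆⋃ (i , x∈) = _ , proj₂ (leaf i) , ∈-++⁺ˡ x∈

        below-vertex : ∀ {s} → All Branch s → ∃[ i ] s ⊆ vertex i
        below-vertex [] = 0 , λ ()
        below-vertex ((i , x∈) ∷ bs) with below-vertex bs
        ... | j , s⊆ = i ℕ.⊔ j , λ
          { (here refl) → vertex-⊆ (ℕ.m≤m⊔n i j) x∈
          ; (there y∈)  → vertex-⊆ (ℕ.m≤n⊔m i j) (s⊆ y∈) }

        absurd : ⊥
        absurd with covering Branch (unbounded⇒infinite branch-unbounded) branch⊆⋃
        ... | s , p , _ , bs , _ with below-vertex bs
        ...   | i , s⊆ = ℕ.1+n≰n (ℕ.≤-trans (ℕ.m≤n⊔m i (suc (length s)))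
          (subst (ℕ._≤ length s) (length-vertex K)
            (subst (λ v → length (vertex K) ℕ.≤ length v) (sym s≡)
              (length-++-≤ˡ (vertex K)))))
          where
          -- Deep enough for the vertex to contain `s` and to be longer than `s`.
          K = i ℕ.⊔ suc (length s)
          s≡ : s ≡ vertex K ++ proj₁ (leaf K)
          s≡ = proj₂ thin p (proj₂ (leaf K)) (∈-++⁺ˡ ∘ vertex-⊆ (ℕ.m≤m⊔n i _) ∘ s⊆)

    abstract
      -- Otherwise there is an infinite path through initial segments of members. Covering gives a
      -- member `s` inside its branch, and thinness identifies `s` with a longer member further
      -- along the path.
      bar : Bar B
      bar = by-contradiction Path.absurd

    abstract
      -- Covering is applied to the union of `w` and `Z beyond w`.
      meet : Increasing w → All (⋃ B) w → Unbounded Z → Z ⊆′ ⋃ B →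
             ∃[ s ] B s × ((∃[ c ] w ≡ s ++ c) ⊎ (∃[ r ] s ≡ w ++ r × All (Z beyond w) r))
      meet {w = w} {Z = Z} inc w⊆ ub Z⊆
        with covering (λ x → x ∈ w ⊎ (Z beyond w) x)
               (unbounded⇒infinite λ n →
                 let (m , le , z) = beyond-unbounded w ub n in m , le , inj₂ z)
               [ All.lookup w⊆ , Z⊆ ∘ proj₁ ]
      ... | s , p , _ , s⊆ , closed =
        s , p , initial-segment-split w s inc (increasing p) proj₂ s⊆ (closed ∘ inj₁)

    ⊆⋃ : B s → All (⋃ B) s
    ⊆⋃ p = All.tabulate λ x∈s → _ , p , x∈s

    abstract
      -- If `meet` stops within `u`, the member found is an initial segment of the member `u ++ r`;
      -- thinness makes it `u` itself, and nothing is appended.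
      extension : ∀ u → B (u ++ r) → Unbounded Z → Z ⊆′ ⋃ B →
                  ∃[ r′ ] B (u ++ r′) × All (Z beyond u) r′
      extension u p ub Z⊆
        with meet (increasing-++ˡ u (increasing p)) (proj₁ (++⁻ u (⊆⋃ p))) ub Z⊆
      ... | _ , q , inj₂ (r′ , refl , Zr) = r′ , q , Zr
      ... | s , q , inj₁ (c , refl)
        with refl ← ++-conicalˡ c _ (thin-prefix q (subst B (++-assoc s c _) p)) =
        [] , subst B (sym (trans (++-identityʳ (s ++ [])) (++-identityʳ s))) q , []

    -- `meet` continues the tail of `s`. It cannot stop within that tail, which would put a member
    -- properly inside `s`; hence `r` is nonempty and `s` is a proper initial segment.
    successor : B s → Unbounded Z → Z ⊆′ ⋃ B →
                ∃[ r ] B (drop 1 s ++ r) × s ◁ (drop 1 s ++ r) × All (Z beyond s) r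
    successor {s = []} p _ _ = contradiction refl (nonempty p)
    successor {s = n ∷ s} {Z = Z} p ub Z⊆
      with meet {Z = Z beyond (n ∷ s)} (Linked.tail (increasing p)) (All.tail (⊆⋃ p))
             (beyond-unbounded (n ∷ s) ub) (Z⊆ ∘ proj₁)
    ... | t , q , inj₁ (c , refl) = contradiction (cong length (proj₂ thin q p (there ∘ ∈-++⁺ˡ)))
      (ℕ.<⇒≢ (s≤s (length-++-≤ˡ t)))
    ... | _ , q , inj₂ (r , refl , Zr) =
      r , q , (n , inc , ++⇒Prefix (n ∷ s) , s≢) , All.map proj₁ Zr
      where
      inc = increasing-∷
              (++⁺ (increasing-head (increasing p)) (All.map (All.head ∘ proj₂ ∘ proj₁) Zr))
              (increasing q)
      s≢ : n ∷ s ≢ n ∷ s ++ r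
      s≢ eq with refl ← ++-identityʳ-unique (n ∷ s) eq =
        contradiction
          (cong length (proj₂ thin q p (there ∘ subst (_ ∈_) (++-identityʳ s))))
          (ℕ.<⇒≢ (s≤s (ℕ.≤-reflexive (cong length (++-identityʳ s)))))

    -- The member met along `n ∷ t` cannot be `n ∷ t` or extend it, since it would then properly
    -- contain `t`.
    predecessor : B t → Increasing (n ∷ t) → ⋃ B n →
                  ∃[ s ] B s × s ◁ t × ∃[ c ] n ∷ t ≡ s ++ c
    predecessor {t} {n} q inc n∈ with meet inc (n∈ ∷ ⊆⋃ q) ⋃-unbounded id
    ... | s , p , inj₁ (c , eq) =
      s , p , (n , inc , subst (Prefix _≡_ s) (sym eq) (++⇒Prefix s) , s≢) , c , eq
      where
      s≢ : s ≢ n ∷ t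
      s≢ refl = contradiction (cong length (proj₂ thin q p there)) (ℕ.<⇒≢ ℕ.≤-refl)
    ... | _ , p , inj₂ (r , refl , _) =
      contradiction (cong length (proj₂ thin q p (there ∘ ∈-++⁺ˡ)))
        (ℕ.<⇒≢ (s≤s (length-++-≤ˡ t)))

    module _ (ubX : Unbounded X) (X⊆ : X ⊆′ ⋃ B) where

      private
        Restricted : Pred (List ℕ) 0ℓ
        Restricted s = B s × All X s

      restrict : Barrier
      restrict = record
        { Member    = Restricted
        ; isBarrier = record
          { increasing = increasing ∘ proj₁
          ; infinite   = infinite′
          ; antichain  = λ p q → antichain (proj₁ p) (proj₁ q)
          ; covering   = covering′
          }
        }
        where
        ⋃⊆X : ⋃ Restricted ⊆′ X
        ⋃⊆X (s , (_ , Xs) , x∈s) = All.lookup Xs x∈s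

        infinite′ : Infinite (≡.setoid (List ℕ)) Restricted
        -- A member found beyond all entries of the supposed list `ss` would itself have to occur in
        -- `ss`.
        infinite′ (ss , h) with covering (X beyond List.concat ss)
                                  (unbounded⇒infinite (beyond-unbounded (List.concat ss) ubX))
                                  (X⊆ ∘ proj₁)
        ... | []    , p , s≢[] , _ = s≢[] refl
        ... | n ∷ s , p , _ , (n∈ ∷ s⊆) , _ =
          ℕ.<-irrefl refl (All.lookup (proj₂ n∈)
            (∈-concat⁺′ (here refl) (h (n ∷ s) (p , All.map proj₁ (n∈ ∷ s⊆)))))

        covering′ : ∀ Y → Infinite (≡.setoid ℕ) Y → Y ⊆′ ⋃ Restricted →
                    ∃[ s ] Restricted s × s ≢ [] × s InitialSegmentOf Y
        covering′ Y inf Y⊆ with covering Y inf (X⊆ ∘ ⋃⊆X ∘ Y⊆)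
        ... | s , p , s≢[] , Ys , closed =
          s , (p , All.map (⋃⊆X ∘ Y⊆) Ys) , s≢[] , Ys , closed

  -- Collapsing the image of a sub-barrier shows that its order type is no larger.
  module Collapse (α : CountableOrdinal) (D : Pred (CountableOrdinal.Carrier α) 0ℓ) where
    open CountableOrdinal α renaming (trans to <-trans)

    private
      Least : Pred Carrier ℓ → Pred Carrier ℓ
      Least Q c = Q c × (∀ b → b < c → ¬ Q b)

      leastOr : Carrier → Pred Carrier ℓ → Carrier
      leastOr c Q with em {P = ∃ (Least Q)}
      ... | yes (b , _) = b
      ... | no _        = c

      leastOr-least : (Q : Pred Carrier ℓ) → ∀ c → ∃ Q → Least Q (leastOr c Q)
      leastOr-least Q c (b , q) with em {P = ∃ (Least Q)}
      ... | yes (_ , l) = l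
      ... | no none     = contradiction (minimal Q (wellFounded b) q) none

      least-unique : {Q R : Pred Carrier ℓ} → Q ⊆′ R → R ⊆′ Q →
                     ∀ {b c} → Least Q b → Least R c → b ≈ c
      least-unique Q⊆R R⊆Q {b} {c} (q , minQ) (r , minR) with compare b c
      ... | tri< b<c _ _ = contradiction (Q⊆R q) (minR b b<c)
      ... | tri≈ _ b≈c _ = b≈c
      ... | tri> _ _ c<b = contradiction (R⊆Q r) (minQ c c<b)

      collapseAcc : ∀ a → Acc _<_ a → Carrier
      collapseAcc a (acc rs) =
        leastOr a (λ c → ∀ d (d<a : d < a) → D d → collapseAcc d (rs d<a) < c)

      Above : ∀ a → Acc _<_ a → Pred Carrier 0ℓ
      Above a (acc rs) c = ∀ d (d<a : d < a) → D d → collapseAcc d (rs d<a) < c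

      -- The collapse of `d` does not exceed `d`, because `d` is itself a candidate in the
      -- minimisation.
      self-above : ∀ a (p : Acc _<_ a) → Above a p a
      collapseAcc-least : ∀ a (p : Acc _<_ a) → Least (Above a p) (collapseAcc a p)

      self-above a (acc rs) d d<a _ with compare (collapseAcc d (rs d<a)) a
      ... | tri< lt _ _ = lt
      ... | tri≈ _ eq _ = contradiction (self-above d (rs d<a))
        (proj₂ (collapseAcc-least d (rs d<a)) d (<-respʳ-≈ (Eq.sym eq) d<a))
      ... | tri> _ _ gt = contradiction (self-above d (rs d<a))
        (proj₂ (collapseAcc-least d (rs d<a)) d (<-trans d<a gt))

      collapseAcc-least a p@(acc rs) = leastOr-least (Above a p) a (a , self-above a p)

      collapseAcc-cong : ∀ {a b} (p : Acc _<_ a) (q : Acc _<_ b) → a ≈ b →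
                         collapseAcc a p ≈ collapseAcc b q
      collapseAcc-cong {a} {b} p@(acc rs) q@(acc rs′) a≈b = least-unique
        (λ above d d<b Dd → <-respˡ-≈
          (collapseAcc-cong (rs (<-respʳ-≈ (Eq.sym a≈b) d<b)) (rs′ d<b) Eq.refl)
          (above d (<-respʳ-≈ (Eq.sym a≈b) d<b) Dd))
        (λ above d d<a Dd → <-respˡ-≈
          (Eq.sym (collapseAcc-cong (rs d<a) (rs′ (<-respʳ-≈ a≈b d<a)) Eq.refl))
          (above d (<-respʳ-≈ a≈b d<a) Dd))
        (collapseAcc-least a p) (collapseAcc-least b q)

    collapse : Carrier → Carrier
    collapse a = collapseAcc a (wellFounded a)

    collapse-cong : ∀ {a b} → a ≈ b → collapse a ≈ collapse b
    collapse-cong = collapseAcc-cong (wellFounded _) (wellFounded _)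

    collapse-mono : ∀ {a b} → D a → a < b → collapse a < collapse b
    collapse-mono {a} {b} Da a<b with wellFounded b
    ... | q@(acc rs) = <-respˡ-≈ (collapseAcc-cong (rs a<b) (wellFounded a) Eq.refl)
      (proj₁ (collapseAcc-least b q) a a<b Da)

    -- By minimality `c` fails to exceed the collapse of some `d` in `D` below `a`. Either that
    -- collapse is `c`, or the argument repeats at `d`.
    collapse-initial : ∀ {a c} → c < collapse a → ∃[ d ] D d × collapse d ≈ c
    collapse-initial {a} = go (wellFounded a)
      where
      go : ∀ {a} (p : Acc _<_ a) {c} → c < collapseAcc a p → ∃[ d ] D d × collapse d ≈ c
      go {a} p@(acc rs) {c} c< with counterexample (proj₂ (collapseAcc-least a p) c c<)
      ... | d , ¬below with counterexample ¬below
      ...   | d<a , ¬below′ with counterexample ¬below′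
      ...     | Dd , ≮c with compare (collapseAcc d (rs d<a)) c
      ...       | tri< lt _ _ = contradiction lt ≮c
      ...       | tri≈ _ eq _ =
        d , Dd , Eq.trans (collapseAcc-cong (wellFounded d) (rs d<a) Eq.refl) eq
      ...       | tri> _ _ gt = go (rs d<a) gt

  sub-orderType : (α : CountableOrdinal) (𝔅 𝔅′ : Barrier) →
    (∀ {s} → Barrier.Member 𝔅′ s → Barrier.Member 𝔅 s) →
    OrderTypeAtMost α 𝔅 → OrderTypeAtMost α 𝔅′
  sub-orderType α 𝔅 𝔅′ ⊆𝔅 o = record
    { rank        = rank′
    ; isEmbedding = record
      { isOrderHomomorphism = record
        { cong = λ {s} {t} → rank′-cong {s} {t}
        ; mono = λ {s} {t} → rank′-mono {s} {t}
        }
      ; injective           = λ {s} {t} → rank′-injective {s} {t}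
      ; cancel              = λ {s} {t} → rank′-cancel {s} {t}
      }
    ; isInitial   = λ c< → let (d , (s , eq) , eq′) = collapse-initial c<
                           in s , Eq.trans (collapse-cong eq) eq′
    }
    where
    open CountableOrdinal α
    open OrderTypeAtMost o
    module 𝔅 = Barrier 𝔅
    module 𝔅′ = Barrier 𝔅′
    module Rank = IsOrderMonomorphism isEmbedding

    inc : 𝔅′.Carrier → 𝔅.Carrier
    inc (s , p) = s , ⊆𝔅 p

    open Collapse α (λ d → ∃[ s ] rank (inc s) ≈ d)

    rank′ : 𝔅′.Carrier → Carrier
    rank′ s = collapse (rank (inc s))

    rank′-cong : ∀ {s t} → s 𝔅′.≈ t → rank′ s ≈ rank′ t
    rank′-cong eq = collapse-cong (Rank.cong eq)

    rank′-mono : ∀ {s t} → s 𝔅′.<ₗₑₓ t → rank′ s < rank′ t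
    rank′-mono {s} lt = collapse-mono (s , Eq.refl) (Rank.mono lt)

    lex-compare : ∀ (s t : 𝔅′.Carrier) → s 𝔅′.<ₗₑₓ t ⊎ s 𝔅′.≈ t ⊎ t 𝔅′.<ₗₑₓ s
    lex-compare s t with Lex.<-compare sym ℕ.<-cmp (proj₁ s) (proj₁ t)
    ... | tri< lt _ _ = inj₁ lt
    ... | tri≈ _ eq _ = inj₂ (inj₁ (Pointwise-≡⇒≡ eq))
    ... | tri> _ _ gt = inj₂ (inj₂ gt)

    rank′-injective : ∀ {s t} → rank′ s ≈ rank′ t → s 𝔅′.≈ t
    rank′-injective {s} {t} eq with lex-compare s t
    ... | inj₁ lt        = contradiction (rank′-mono {s} {t} lt) (irrefl eq)
    ... | inj₂ (inj₁ s≈t) = s≈t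
    ... | inj₂ (inj₂ gt) = contradiction (rank′-mono {t} {s} gt) (irrefl (Eq.sym eq))

    rank′-cancel : ∀ {s t} → rank′ s < rank′ t → s 𝔅′.<ₗₑₓ t
    rank′-cancel {s} {t} lt with lex-compare s t
    ... | inj₁ s<t       = s<t
    ... | inj₂ (inj₁ eq) = contradiction lt (irrefl (rank′-cong {s} {t} eq))
    ... | inj₂ (inj₂ gt) = contradiction lt (asym (rank′-mono {t} {s} gt))

  -- Bad maps

  module _ {c ℓ₁ ℓ₂} (Q : Preorder c ℓ₁ ℓ₂) where
    open Preorder Q using (Carrier; _≈_; _≲_; module Eq; ≲-respˡ-≈; ≲-respʳ-≈)

    Bad : Pred (List ℕ) 0ℓ → (List ℕ → Carrier) → Set ℓ₂
    Bad B f = ∀ {s t} → B s → B t → s ◁ t → ¬ f s ≲ f t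

    bqo⇒¬bad : ∀ {α} → BQO Q α → (𝔅 : Barrier) → OrderTypeAtMost α 𝔅 →
               ∀ f → ¬ Bad (Barrier.Member 𝔅) f
    bqo⇒¬bad bqo 𝔅 o f bad
      with bqo 𝔅 o (record { to = f ∘ proj₁ ; cong = λ eq → Eq.reflexive (cong f eq) })
    ... | (s , p) , (t , q) , s◁t , fs≲ft = bad p q s◁t fs≲ft

    -- A map on the barrier is extended to all lists, so that values need not
    -- carry proofs of membership.
    ¬bad⇒bqo : ∀ {α} → ((𝔅 : Barrier) → OrderTypeAtMost α 𝔅 →
                         ∀ f → ¬ Bad (Barrier.Member 𝔅) f) → BQO Q α
    ¬bad⇒bqo h 𝔅 o F = by-contradiction λ ¬good → h 𝔅 o f λ p q s◁t fs≲ft →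
      ¬good ((_ , p) , (_ , q) , s◁t , ≲-respʳ-≈ (f≈F q) (≲-respˡ-≈ (f≈F p) fs≲ft))
      where
      open Barrier 𝔅 using () renaming (Member to B)
      open Func F using (to) renaming (cong to to-cong)

      f : List ℕ → Carrier
      f s with em {P = B s}
      ... | yes p = to (s , p)
      ... | no _  = let (_ , _ , s₀ , p₀ , _) = BarrierProperties.⋃-unbounded 𝔅 0 in to (s₀ , p₀)

      f≈F : ∀ {s} (p : B s) → f s ≈ to (s , p)
      f≈F {s} p with em {P = B s}
      ... | yes _ = to-cong refl
      ... | no ¬p = contradiction p ¬p

    -- First entries increase strictly along `◁`, so `q ∘ first` is bad.
    increasing⇒¬bqo : ∀ {α} (q : ℕ → Carrier) → (∀ {i j} → i ℕ.< j → ¬ q i ≲ q j) →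
                       (𝔅 : Barrier) → OrderTypeAtMost α 𝔅 → ¬ BQO Q α
    increasing⇒¬bqo q ≴ 𝔅 o bqo = bqo⇒¬bad bqo 𝔅 o (q ∘ first) λ p p′ s◁t →
      ≴ (◁-first (nonempty p) (nonempty p′) s◁t)
      where open BarrierProperties 𝔅

  -- Posets without infinite antichains

  module _ {c ℓ₁ ℓ₂} (P : Poset c ℓ₁ ℓ₂) where
    open Poset P using (Carrier; _≈_; _≤_; antisym; module Eq)
      renaming (refl to ≤-refl; reflexive to ≤-reflexive; trans to ≤-trans)
    open PosetProperties P using (_<_; <-irrefl; <-trans; <⇒≱; <-respʳ-≈)

    Descending : (ℕ → Carrier) → Set (ℓ₁ ⊔ ℓ₂)
    Descending p = ∀ n → p (suc n) < p n

    descending-< : ∀ {p} → Descending p → ∀ {i j} → i ℕ.< j → p j < p i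
    descending-< {p} desc i<j = go (ℕ.≤⇒≤′ i<j)
      where
      go : ∀ {i j} → suc i ≤′ j → p j < p i
      go {i} ≤′-refl  = desc i
      go (≤′-step le) = <-trans (desc _) (go le)

    wellFounded⇒¬descending : WellFounded _<_ → ∀ {p} → ¬ Descending p
    wellFounded⇒¬descending wf {p} desc = go 0 (wf (p 0))
      where
      go : ∀ n → ¬ Acc _<_ (p n)
      go n (acc rs) = go (suc n) (rs (desc n))

    descending⊎wellFounded : ∃ Descending ⊎ WellFounded _<_
    descending⊎wellFounded with em {P = WellFounded _<_}
    ... | yes wf = inj₂ wf
    ... | no ¬wf = inj₁ (proj₁ ∘ q , λ n → proj₁ (proj₂ (next (q n))))
      where
      next : (x : ∃[ x ] ¬ Acc _<_ x) → ∃[ y ] y < proj₁ x × ¬ Acc _<_ y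
      next (x , ¬ax) with em {P = ∃[ y ] y < x × ¬ Acc _<_ y}
      ... | yes y    = y
      ... | no none = contradiction
        (acc λ {y} y<x → by-contradiction λ ¬ay → none (y , y<x , ¬ay)) ¬ax

      q : ℕ → ∃[ x ] ¬ Acc _<_ x
      q zero    = counterexample ¬wf
      q (suc n) = let (y , _ , ¬ay) = next (q n) in y , ¬ay

    Comparable : Carrier → Carrier → Set ℓ₂
    Comparable x y = x ≤ y ⊎ y ≤ x

    comparable-resp : ∀ {x x′ y y′} → x ≈ x′ → y ≈ y′ → Comparable x y → Comparable x′ y′
    comparable-resp x≈ y≈ = Sum.map (resp x≈ y≈) (resp y≈ x≈)
      where
      resp : ∀ {x x′ y y′} → x ≈ x′ → y ≈ y′ → x ≤ y → x′ ≤ y′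
      resp x≈ y≈ x≤y = ≤-trans (≤-reflexive (Eq.sym x≈)) (≤-trans x≤y (≤-reflexive y≈))

    abstract
      comparable-terms : NoInfiniteAntichain P → (p : ℕ → Carrier) →
                         ∃[ i ] ∃[ j ] i ℕ.< j × Comparable (p i) (p j)
      comparable-terms noac p = by-contradiction λ none → noac Range
          (λ (lift (i , x≈)) (lift (j , y≈)) x≉y cmp → incomparable none i j
            (λ i≡j → x≉y (Eq.trans x≈ (Eq.trans (Eq.reflexive (cong p i≡j)) (Eq.sym y≈))))
            (comparable-resp x≈ y≈ cmp))
          (λ (xs , h) → repetition none xs λ i → h (p i) (lift (i , Eq.refl)))
        where
        Range : Subset P
        Range x = Lift (c ⊔ ℓ₁ ⊔ ℓ₂) (∃[ i ] x ≈ p i)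

        None : Set ℓ₂
        None = ¬ (∃[ i ] ∃[ j ] i ℕ.< j × Comparable (p i) (p j))

        incomparable : None → ∀ i j → i ≢ j → ¬ Comparable (p i) (p j)
        incomparable none i j i≢j cmp with ℕ.<-cmp i j
        ... | tri< i<j _ _ = none (i , j , i<j , cmp)
        ... | tri≈ _ i≡j _ = i≢j i≡j
        ... | tri> _ _ j<i = none (j , i , j<i , Sum.swap cmp)

        repetition : None → ∀ xs → (∀ i → Any (p i ≈_) xs) → ⊥
        repetition none xs position
          -- Two of the first `length xs + 1` terms are matched with the same entry of `xs`, so they
          -- are equal up to `≈` and comparable.
          with pigeonhole {n = suc (length xs)} ℕ.≤-refl (λ i → Any.index (position (Fin.toℕ i)))
        ... | i , j , i<j , eq = none (Fin.toℕ i , Fin.toℕ j , i<j , inj₁ (≤-reflexive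
          (Eq.trans (lookup-index (position (Fin.toℕ i)))
            (Eq.trans (Eq.reflexive (cong (List.lookup xs) eq))
              (Eq.sym (lookup-index (position (Fin.toℕ j))))))))

    -- Constant and rising behaviour of a map on a barrier

    module _ (noac : NoInfiniteAntichain P) (wf : WellFounded _<_)
             (𝔅 : Barrier) (f : List ℕ → Carrier) where
      open Barrier 𝔅 using () renaming (Member to B)
      open BarrierProperties 𝔅

      Constant Rising : List ℕ → Pred ℕ 0ℓ → Set _
      Constant u Z = ∀ r r′ → B (u ++ r) → B (u ++ r′) → All Z r → All Z r′ →
                     f (u ++ r) ≈ f (u ++ r′)
      Rising u Z = ∀ r r′ → B (u ++ r) → B (u ++ r′) → All Z r → All (Z beyond r) r′ →
                   f (u ++ r) < f (u ++ r′)

      private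
        -- A sequence of members through `u` in which each `term` lies beyond all earlier ones,
        -- collected in `history`.
        module Spread (u : List ℕ) {r₀} (p₀ : B (u ++ r₀))
                      {Z} (ub : Unbounded Z) (Z⊆ : Z ⊆′ ⋃ B) where
          after : ∀ w → ∃[ r ] B (u ++ r) × All (Z beyond w) r
          after w with extension u p₀ (beyond-unbounded w ub) (Z⊆ ∘ proj₁)
          ... | r , p , Zr = r , p , All.map proj₁ Zr

          history : ℕ → List ℕ
          history zero    = []
          history (suc n) = proj₁ (after (history n)) ++ history n

          term : ℕ → List ℕ
          term n = proj₁ (after (history n))

          term-B : ∀ n → B (u ++ term n)
          term-B n = proj₁ (proj₂ (after (history n)))

          term-Z : ∀ n → All Z (term n)
          term-Z n = All.map proj₁ (proj₂ (proj₂ (after (history n))))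

          history-⊆ : ∀ {i j} → i ℕ.≤ j → history i ⊆ history j
          history-⊆ = ≤-induction (λ i j → history i ⊆ history j) id
            (λ {_} {j} ih x∈ → ∈-++⁺ʳ (term j) (ih x∈))

          term-beyond : ∀ {i j} → i ℕ.< j → All (Z beyond term i) (term j)
          term-beyond {i} {j} i<j =
            All.map (λ (z , lt) → z , anti-mono (history-⊆ i<j ∘ ∈-++⁺ˡ) lt)
              (proj₂ (proj₂ (after (history j))))

      _≤⟨_⟩_ : List ℕ → List ℕ → List ℕ → Set ℓ₂
      r ≤⟨ u ⟩ r′ = f (u ++ r) ≤ f (u ++ r′)

      OnPairs : List ℕ → Pred ℕ 0ℓ → (List ℕ → List ℕ → Set ℓ) → Set ℓ
      OnPairs u = Pairs (B ∘ (u ++_)) (λ _ → B ∘ (u ++_))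

      ramsey : ∀ u (R : List ℕ → List ℕ → Set ℓ) → Unbounded Y →
        ∃[ Z ] Unbounded Z × Z ⊆′ Y × (OnPairs u Z R ⊎ OnPairs u Z (λ r r′ → ¬ R r r′))
      ramsey u = nash-williams-pairs (thin-++ thin u) (bar-++ bar u)
        (λ _ → thin-++ thin u) (λ _ → bar-++ bar u)

      pairs-antitone : ∀ u {R : List ℕ → List ℕ → Set ℓ} → Z ⊆′ Y → OnPairs u Y R → OnPairs u Z R
      pairs-antitone u Z⊆Y h r r′ p p′ Zr Zr′ =
        h r r′ p p′ (All.map Z⊆Y Zr) (All.map (λ (z , lt) → Z⊆Y z , lt) Zr′)

      module _ (u : List ℕ) {r₀} (p₀ : B (u ++ r₀)) (ub : Unbounded Z) (Z⊆ : Z ⊆′ ⋃ B) where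
        open Spread u p₀ ub Z⊆

        -- Two members through `u` need not lie one beyond the other, so both are compared with a
        -- third beyond both.
        constant-if-≤≥ : OnPairs u Z _≤⟨ u ⟩_ → OnPairs u Z (λ r r′ → r′ ≤⟨ u ⟩ r) → Constant u Z
        constant-if-≤≥ ≤↑ ≤↓ r r′ p p′ Zr Zr′ =
          let (t , q , Zt) = after (r ++ r′)
              same : ∀ r → B (u ++ r) → All Z r → All (Z beyond r) t → f (u ++ r) ≈ f (u ++ t)
              same = λ r p Zr Zt → antisym (≤↑ r t p q Zr Zt) (≤↓ r t p q Zr Zt)
          in Eq.trans (same r p Zr (All.map (λ (z , lt) → z , proj₁ (++⁻ r lt)) Zt))
               (Eq.sym (same r′ p′ Zr′ (All.map (λ (z , lt) → z , proj₂ (++⁻ r lt)) Zt)))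

        rising-if-≤≱ : OnPairs u Z _≤⟨ u ⟩_ → OnPairs u Z (λ r r′ → ¬ r′ ≤⟨ u ⟩ r) → Rising u Z
        rising-if-≤≱ ≤↑ ≰↓ r r′ p p′ Zr Zr′ = ≤↑ r r′ p p′ Zr Zr′ ,
          λ eq → ≰↓ r r′ p p′ Zr Zr′ (≤-reflexive (Eq.sym eq))

        falling-absurd : OnPairs u Z (λ r r′ → ¬ r ≤⟨ u ⟩ r′) →
                         OnPairs u Z (λ r r′ → r′ ≤⟨ u ⟩ r) → ⊥
        falling-absurd ≰↑ ≤↓ = wellFounded⇒¬descending wf {p = λ n → f (u ++ term n)} λ n →
          onTerms ≤↓ n , λ eq → onTerms ≰↑ n (≤-reflexive (Eq.sym eq))
          where
          onTerms : {R : List ℕ → List ℕ → Set ℓ} → OnPairs u Z R → ∀ n → R (term n) (term (suc n))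
          onTerms h n = h (term n) (term (suc n)) (term-B n) (term-B (suc n)) (term-Z n)
            (term-beyond {n} {suc n} ℕ.≤-refl)

        incomparable-absurd : OnPairs u Z (λ r r′ → ¬ r ≤⟨ u ⟩ r′) →
                              OnPairs u Z (λ r r′ → ¬ r′ ≤⟨ u ⟩ r) → ⊥
        incomparable-absurd ≰↑ ≰↓ =
          let (i , j , i<j , cmp) = comparable-terms noac (λ n → f (u ++ term n))
          in [ ≰↑ (term i) (term j) (term-B i) (term-B j) (term-Z i) (term-beyond {i} {j} i<j)
             , ≰↓ (term i) (term j) (term-B i) (term-B j) (term-Z i) (term-beyond {i} {j} i<j)
             ] cmp

      -- Homogeneity for both `≤` and its converse leaves four cases. Along a spread sequence,
      -- falling contradicts well-foundedness and incomparability contradicts the antichain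
      -- hypothesis.
      constant⊎rising-inside : ∀ u → Unbounded Y → Y ⊆′ ⋃ B →
        ∃[ Z ] Unbounded Z × Z ⊆′ Y × (Constant u Z ⊎ Rising u Z)
      constant⊎rising-inside u ubY Y⊆ with em {P = ∃[ r ] B (u ++ r)}
      ... | no none = _ , ubY , id , inj₁ (λ _ _ p → contradiction (_ , p) none)
      ... | yes (_ , p₀) with ramsey u (_≤⟨ u ⟩_) ubY
      ...   | V , ubV , V⊆Y , up with ramsey u (λ r r′ → r′ ≤⟨ u ⟩ r) ubV
      ...     | W , ubW , W⊆V , down = W , ubW , V⊆Y ∘ W⊆V ,
        combine (Sum.map (pairs-antitone u W⊆V) (pairs-antitone u W⊆V) up) down
        where
        W⊆⋃ : W ⊆′ ⋃ B
        W⊆⋃ = Y⊆ ∘ V⊆Y ∘ W⊆V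

        combine : OnPairs u W _≤⟨ u ⟩_ ⊎ OnPairs u W (λ r r′ → ¬ r ≤⟨ u ⟩ r′) →
                  OnPairs u W (λ r r′ → r′ ≤⟨ u ⟩ r) ⊎ OnPairs u W (λ r r′ → ¬ r′ ≤⟨ u ⟩ r) →
                  Constant u W ⊎ Rising u W
        combine (inj₁ ≤↑) (inj₁ ≤↓) = inj₁ (constant-if-≤≥ u p₀ ubW W⊆⋃ ≤↑ ≤↓)
        combine (inj₁ ≤↑) (inj₂ ≰↓) = inj₂ (rising-if-≤≱ u p₀ ubW W⊆⋃ ≤↑ ≰↓)
        combine (inj₂ ≰↑) (inj₁ ≤↓) = ⊥-elim (falling-absurd u p₀ ubW W⊆⋃ ≰↑ ≤↓)
        combine (inj₂ ≰↑) (inj₂ ≰↓) = ⊥-elim (incomparable-absurd u p₀ ubW W⊆⋃ ≰↑ ≰↓)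

      -- Fusion refines arbitrary unbounded sets, so `Y` is first split by `⋃ B`. Outside it only
      -- the empty `r` can complete `u`, and `f` is constant.
      constant⊎rising : ∀ u → Unbounded Y →
        ∃[ Z ] Unbounded Z × Z ⊆′ Y × (Constant u Z ⊎ Rising u Z)
      constant⊎rising u ubY with split-unbounded (⋃ B) ubY
      ... | Z , ubZ , Z⊆Y , inj₁ inside =
        let (W , ubW , W⊆Z , h) = constant⊎rising-inside u ubZ inside in W , ubW , Z⊆Y ∘ W⊆Z , h
      ... | Z , ubZ , Z⊆Y , inj₂ outside = Z , ubZ , Z⊆Y , inj₁ constant
        where
        empty : ∀ r → B (u ++ r) → All Z r → r ≡ []
        empty []      _ _        = refl
        empty (x ∷ r) p (Zx ∷ _) =
          contradiction (_ , p , ∈-++⁺ʳ u (here refl)) (outside Zx)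

        constant : Constant u Z
        constant r r′ p p′ Zr Zr′ =
          Eq.reflexive (cong (f ∘ (u ++_)) (trans (empty r p Zr) (sym (empty r′ p′ Zr′))))

      -- For `s ◁ t`, the element `g t` refutes `f s ≤succ f t`, and the element `f s` refutes
      -- `g s ≤pred g t`.
      Separates : Pred ℕ 0ℓ → (List ℕ → Carrier) → Set (ℓ₁ ⊔ ℓ₂)
      Separates X g = (∀ {t} → B t → All X t → f t < g t) ×
        (∀ {s t} → B s → B t → All X s → All X t → s ◁ t → ¬ f s ≤ g t)

      -- Cutting and raising

      module _ (bad : Bad (Poset.preorder P) B f)
               {X₁} (X₁-unbounded : Unbounded X₁) (X₁⊆⋃ : X₁ ⊆′ ⋃ B)
               (constant⊎rising₁ : ∀ {u} → Increasing u → All X₁ u →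
                  Constant u (X₁ beyond u) ⊎ Rising u (X₁ beyond u)) where
        private
          -- The first alternative makes `length s` a candidate, so that a least one exists.
          Settled : List ℕ → ℕ → Set _
          Settled s n = n ≡ length s ⊎ Constant (take n s) (X₁ beyond take n s)

          cut-minimal : ∀ s → ∃[ n ] Settled s n × (∀ m → m ℕ.< n → ¬ Settled s m)
          cut-minimal s = minimal (Settled s) (<-wellFounded (length s)) (inj₁ refl)

          -- The least n such that f is constant on the members extending take n s.
          cut : List ℕ → ℕ
          cut s = proj₁ (cut-minimal s)

          cut≤length : ∀ s → cut s ℕ.≤ length s
          cut≤length s = ℕ.≮⇒≥ λ lt → proj₂ (proj₂ (cut-minimal s)) (length s) lt (inj₁ refl)

          -- Constancy at the cut gives this; when the cut is all of `s`, thinness makes the two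
          -- members equal.
          f-cut : ∀ s e → B s → B (take (cut s) s ++ e) → All X₁ s → All X₁ (take (cut s) s ++ e) →
                  f s ≈ f (take (cut s) s ++ e)
          f-cut s e p q Xs Xe with proj₁ (proj₂ (cut-minimal s))
          ... | inj₁ eq = Eq.reflexive (cong f (proj₂ thin p q
            λ x∈s → ∈-++⁺ˡ (subst (_ ∈_)
              (sym (trans (cong (λ n → take n s) eq) (take-all (length s) s ℕ.≤-refl))) x∈s)))
          ... | inj₂ const = subst (λ s′ → f s′ ≈ f (take (cut s) s ++ e)) (take++drop≡id (cut s) s)
            (const _ _ p′ q
              (rest _ p′ (subst (All X₁) (sym (take++drop≡id (cut s) s)) Xs)) (rest _ q Xe))
            where
            p′ : B (take (cut s) s ++ drop (cut s) s)
            p′ = subst B (sym (take++drop≡id (cut s) s)) p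

            rest : ∀ r → B (take (cut s) s ++ r) → All X₁ (take (cut s) s ++ r) →
                   All (X₁ beyond take (cut s) s) r
            rest r q Xr = All.zip (proj₂ (++⁻ (take (cut s) s) Xr) ,
              increasing-≪ (take (cut s) s) (proj₁ thin q))

          -- In the other homogeneous case the cut drops from each member to every successor, and
          -- iterating `successor` would give an infinite descent in ℕ.
          monotone-cut : ∃[ X ] Unbounded X × X ⊆′ X₁ ×
            (∀ s r → B s → B (drop 1 s ++ r) → All X s → All (X beyond s) r →
              cut s ℕ.≤ cut (drop 1 s ++ r))
          monotone-cut
            with nash-williams-pairs thin bar
                   (λ s → thin-++ thin (drop 1 s)) (λ s → bar-++ bar (drop 1 s))
                   (λ s r → cut s ℕ.≤ cut (drop 1 s ++ r)) X₁-unbounded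
          ... | X , ubX , X⊆ , inj₁ mono = X , ubX , X⊆ , mono
          ... | X , ubX , X⊆ , inj₂ ¬mono = contradiction
            (let (_ , _ , _ , p₀ , _) = ⋃-unbounded 0
                 (s , p , Xs) = extension [] p₀ ubX (X₁⊆⋃ ∘ X⊆)
             in go s (<-wellFounded (cut s)) p (All.map proj₁ Xs)) id
            where
            go : ∀ s → Acc ℕ._<_ (cut s) → B s → All X s → ⊥
            go s (acc rs) p Xs with successor p ubX (X₁⊆⋃ ∘ X⊆)
            ... | r , q , _ , Xr = go (drop 1 s ++ r) (rs (ℕ.≰⇒> (¬mono s r p q Xs Xr))) q
              (++⁺ (drop⁺ 1 Xs) (All.map proj₁ Xr))

          -- The signature's `n` stands for the cut. One entry earlier, at `k`, `f` still rises, so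
          -- continuing from there beyond all of `t` gives a larger value.
          Raises : ℕ → List ℕ → List ℕ → Set (ℓ₁ ⊔ ℓ₂)
          Raises n t t⁺ = f t < f t⁺ × B t⁺ × All X₁ t⁺ × ∃[ k ] ∃[ r ]
            n ≡ suc k × t⁺ ≡ take k t ++ r × All (λ x → All (ℕ._< x) t) r

          -- Rules out a cut at `0`, so that one entry can be given up: constancy would give `t` and
          -- a successor of `t` the same value.
          ¬constant-[] : B t → All X₁ t → ¬ Constant [] (X₁ beyond [])
          ¬constant-[] {t} p Xt const =
            let (r , q , t◁ , Xr) = successor p X₁-unbounded X₁⊆⋃
            in bad p q t◁ (≤-reflexive (const t (drop 1 t ++ r) p q (All.map (_, []) Xt)
                 (All.map (_, []) (++⁺ (drop⁺ 1 Xt) (All.map proj₁ Xr)))))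

          rising-raises : ∀ k → B t → All X₁ t → Rising (take k t) (X₁ beyond take k t) →
                          ∃[ t⁺ ] Raises (suc k) t t⁺
          rising-raises {t} k p Xt rising =
            let p′ = subst B (sym (take++drop≡id k t)) p
                (r , q , Xr) =
                  extension (take k t) p′ (beyond-unbounded t X₁-unbounded) (X₁⊆⋃ ∘ proj₁)
            in take k t ++ r ,
               subst (λ t′ → f t′ < f (take k t ++ r)) (take++drop≡id k t)
                 (rising (drop k t) r p′ q
                   (All.zip (drop⁺ k Xt , increasing-≪ (take k t) (proj₁ thin p′)))
                   (All.map (λ ((x , t<x) , u<x) → (x , u<x) , drop⁺ k t<x) Xr)) ,
               q , ++⁺ (take⁺ k Xt) (All.map (proj₁ ∘ proj₁) Xr) , k , r , refl , refl ,
               All.map (proj₂ ∘ proj₁) Xr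

          raise-at : ∀ n → B t → All X₁ t → Settled t n → (∀ m → m ℕ.< n → ¬ Settled t m) →
                     ∃[ t⁺ ] Raises n t t⁺
          raise-at {[]}    zero p _  (inj₁ _)     _ = contradiction refl (nonempty p)
          raise-at {_ ∷ _} zero p Xt (inj₂ const) _ = contradiction const (¬constant-[] p Xt)
          raise-at {[]}    zero p Xt (inj₂ const) _ = contradiction const (¬constant-[] p Xt)
          raise-at {t} (suc k) p Xt _ least =
            [ (λ const → contradiction (inj₂ const) (least k ℕ.≤-refl)) , rising-raises k p Xt ]′
              (constant⊎rising₁ (increasing-++ˡ (take k t) (proj₁ thin p′)) (take⁺ k Xt))
            where
            p′ : B (take k t ++ drop k t)
            p′ = subst B (sym (take++drop≡id k t)) p

          raise : B t → All X₁ t → ∃[ t⁺ ] Raises (cut t) t t⁺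
          raise {t} p Xt =
            let (n , settled , least) = cut-minimal t in raise-at n p Xt settled least

          -- The predecessor of t⁺ within n ∷ t⁺ agrees with s up to cut s, so f takes
          -- the same value there as at s.
          f-≰-raised : ∀ {t⁺} → B s → B t → All X₁ s → All X₁ t → s ◁ t → cut s ℕ.≤ cut t →
                       Raises (cut t) t t⁺ → ¬ f s ≤ f t⁺
          f-≰-raised {[]} p = contradiction refl (nonempty p)
          f-≰-raised {s@(n ∷ s₀)} {t} p q Xs@(Xn ∷ _) Xt (_ , inc , refl ∷ pre , _) cut≤
                     (_ , q⁺ , Xt⁺ , k , r , cut≡ , refl , t<r) fs≤ =
            bad p″ q⁺ s″◁ (≤-trans (≤-reflexive (Eq.sym fs≈)) fs≤)
            where
            v = take (cut s) s

            below : ∀ t → B t → All (n ℕ.<_) t → ∀ {x} → All (ℕ._< x) t → n ℕ.< x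
            below []      q _         _         = contradiction refl (nonempty q)
            below (_ ∷ _) _ (n<y ∷ _) (y<x ∷ _) = ℕ.<-trans n<y y<x

            n<t : All (n ℕ.<_) t
            n<t = increasing-head inc

            inc⁺ : Increasing (n ∷ take k t ++ r)
            inc⁺ = increasing-∷ (++⁺ (take⁺ k n<t) (All.map (below t q n<t) t<r)) (proj₁ thin q⁺)

            pred = predecessor q⁺ inc⁺ (X₁⊆⋃ Xn)
            s″   = proj₁ pred
            p″   = proj₁ (proj₂ pred)
            s″◁  = proj₁ (proj₂ (proj₂ pred))
            c″   = proj₁ (proj₂ (proj₂ (proj₂ pred)))

            s″++c″≡ : n ∷ take k t ++ r ≡ s″ ++ c″
            s″++c″≡ = proj₂ (proj₂ (proj₂ (proj₂ pred)))

            X″ : All X₁ s″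
            X″ = proj₁ (++⁻ s″ (subst (All X₁) s″++c″≡ (Xn ∷ Xt⁺)))

            -- The entry `n` makes up for the one given up in `take k t`: as `cut s` is at most
            -- `suc k`, all of `v` is still there.
            v-prefix : ∃[ d ] n ∷ take k t ≡ v ++ d
            v-prefix = let (c , t≡) = Prefix⇒++ pre in
              subst (λ t → ∃[ d ] n ∷ take k t ≡ v ++ d) (sym t≡)
                (take-++-prefix s (subst (cut s ℕ.≤_) cut≡ cut≤) (cut≤length s))

            agree : (∃[ e ] s″ ≡ v ++ e) ⊎ (∃[ e ] v ≡ s″ ++ e)
            agree = prefixes-comparable s″ v
              (trans (sym s″++c″≡) (trans (cong (_++ r) (proj₂ v-prefix)) (++-assoc v _ r)))

            fs≈ : f s ≈ f s″
            fs≈ = [ (λ (e , s″≡) → subst (λ z → f s ≈ f z) (sym s″≡)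
                      (f-cut s e p (subst B s″≡ p″) Xs (subst (All X₁) s″≡ X″)))
                  , (λ (e , v≡) → Eq.reflexive (cong f (sym (proj₂ thin p″ p λ x∈ →
                      subst (_ ∈_) (take++drop≡id (cut s) s)
                        (∈-++⁺ˡ (subst (_ ∈_) (sym v≡) (∈-++⁺ˡ x∈)))))))
                  ]′ agree

          raised : List ℕ → Carrier
          raised t with em {P = B t × All X₁ t}
          ... | yes (p , Xt) = f (proj₁ (raise p Xt))
          ... | no _         = f t

          raised-spec : B t → All X₁ t → ∃[ t⁺ ] Raises (cut t) t t⁺ × raised t ≡ f t⁺
          raised-spec {t} p Xt with em {P = B t × All X₁ t}
          ... | yes (p , Xt) = proj₁ (raise p Xt) , proj₂ (raise p Xt) , refl
          ... | no ¬p        = contradiction (p , Xt) ¬p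

        separated-within : ∃[ X ] Unbounded X × X ⊆′ ⋃ B × ∃ (Separates X)
        separated-within = let (X , ubX , X⊆ , mono) = monotone-cut in
          X , ubX , X₁⊆⋃ ∘ X⊆ , raised ,
          (λ {t} p Xt → let (_ , (lt , _) , eq) = raised-spec p (All.map X⊆ Xt)
                        in subst (f t <_) (sym eq) lt) ,
          (λ {s} {t} p q Xs Xt s◁t →
            let (_ , raises , eq) = raised-spec q (All.map X⊆ Xt)
                (c , t≡ , s<c) = ◁-tail (nonempty p) s◁t
                Xc = proj₂ (++⁻ (drop 1 s) (subst (All X) t≡ Xt))
                cut≤ = subst (λ t → cut s ℕ.≤ cut t) (sym t≡)
                         (mono s c p (subst B t≡ q) Xs (All.zip (Xc , s<c)))
            in subst (λ y → ¬ f s ≤ y) (sym eq)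
                 (f-≰-raised p q (All.map X⊆ Xs) (All.map X⊆ Xt) s◁t cut≤ raises))

      abstract
        separated : Bad (Poset.preorder P) B f → ∃[ X ] Unbounded X × X ⊆′ ⋃ B × ∃ (Separates X)
        separated bad =
          let (X , ubX , X⊆ , h) = diagonal (λ u Z → Constant u Z ⊎ Rising u Z)
                (λ u Z⊆Y → Sum.map
                  (λ h r r′ p p′ Zr Zr′ → h r r′ p p′ (All.map Z⊆Y Zr) (All.map Z⊆Y Zr′))
                  (pairs-antitone u Z⊆Y))
                (λ u → constant⊎rising u) ⋃-unbounded
          in separated-within bad ubX X⊆ h

    ≤-<-trans : ∀ {x y z} → x ≤ y → y < z → x < z
    ≤-<-trans x≤y y<z = ≤-trans x≤y (proj₁ y<z) ,
      λ x≈z → <⇒≱ y<z (≤-trans (≤-reflexive (Eq.sym x≈z)) x≤y)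

    <-≤-trans : ∀ {x y z} → x < y → y ≤ z → x < z
    <-≤-trans x<y y≤z = ≤-trans (proj₁ x<y) y≤z ,
      λ x≈z → <⇒≱ x<y (≤-trans y≤z (≤-reflexive (Eq.sym x≈z)))

    -- Maximal antichains

    Incomparable : Carrier → Carrier → Set ℓ₂
    Incomparable x y = ¬ Comparable x y

    private
      -- Otherwise every finite antichain containing x could be extended, and
      -- iterating would give an infinite one.
      module Extending (noac : NoInfiniteAntichain P) (x : Carrier) where
        FiniteAntichain : Set (c ⊔ ℓ₂)
        FiniteAntichain = ∃[ xs ] AllPairs Incomparable xs × x ∈ xs

        Extensible : List Carrier → Set (c ⊔ ℓ₂)
        Extensible xs = ∃[ y ] All (Incomparable y) xs

        module Iterate (extend : ∀ ((xs , _) : FiniteAntichain) → Extensible xs) where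
          chain : ℕ → FiniteAntichain
          chain zero    = x ∷ [] , [] ∷ [] , here refl
          chain (suc n) =
            let (xs , pairs , x∈) = chain n
                (y , y∥) = extend (chain n)
            in y ∷ xs , y∥ ∷ pairs , there x∈

          term : ℕ → Carrier
          term n = proj₁ (extend (chain n))

          chain-⊆ : ∀ {i j} → i ℕ.≤ j → proj₁ (chain i) ⊆ proj₁ (chain j)
          chain-⊆ = ≤-induction (λ i j → proj₁ (chain i) ⊆ proj₁ (chain j)) id
            (λ ih x∈ → there (ih x∈))

          absurd : ⊥
          absurd = let (i , j , i<j , cmp) = comparable-terms noac term in
            All.lookup (proj₂ (extend (chain j))) (chain-⊆ {suc i} {j} i<j (here refl))
              (Sum.swap cmp)

        abstract
          inextensible : Σ FiniteAntichain λ (xs , _) → ¬ Extensible xs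
          inextensible = counterexample Iterate.absurd

    pairs-lookup : ∀ {R : Rel Carrier ℓ} → (∀ {x y} → R x y → R y x) →
                   ∀ {xs x y} → AllPairs R xs → x ∈ xs → y ∈ xs → x ≡ y ⊎ R x y
    pairs-lookup R-sym (_ ∷ _)  (here refl) (here refl) = inj₁ refl
    pairs-lookup R-sym (r ∷ _)  (here refl) (there y∈)  = inj₂ (All.lookup r y∈)
    pairs-lookup R-sym (r ∷ _)  (there x∈)  (here refl) = inj₂ (R-sym (All.lookup r x∈))
    pairs-lookup R-sym (_ ∷ rs) (there x∈)  (there y∈)  = pairs-lookup R-sym rs x∈ y∈

    open MaximalAntichain

    listAntichain : ∀ xs → AllPairs Incomparable xs → ¬ (∃[ y ] All (Incomparable y) xs) →
                    MaximalAntichain P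
    listAntichain xs pairs ¬ext = record
      { set         = In
      ; isAntichain = antichain
      ; maximal     = maximal′
      }
      where
      In : Subset P
      In y = Lift (c ⊔ ℓ₁ ⊔ ℓ₂) (Any (y ≈_) xs)

      antichain : IsAntichain P In
      antichain (lift y∈) (lift z∈) y≉z cmp =
        let (y′ , y′∈ , y≈) = find y∈
            (z′ , z′∈ , z≈) = find z∈
        in [ (λ y′≡z′ → y≉z (Eq.trans y≈ (Eq.trans (Eq.reflexive y′≡z′) (Eq.sym z≈))))
           , (λ ∥ → ∥ (comparable-resp y≈ z≈ cmp))
           ]′
             (pairs-lookup (_∘ Sum.swap) pairs y′∈ z′∈)

      maximal′ : ∀ Y → IsAntichain P Y → In ⊆′ Y → Y ⊆′ In
      maximal′ Y acY ⊆Y {y} Yy = by-contradiction λ y∉ → ¬ext (y , All.tabulate λ z∈ cmp →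
        acY Yy (⊆Y (lift (lose z∈ Eq.refl))) (λ y≈z → y∉ (lift (lose z∈ y≈z))) cmp)

    maximalAntichain-∋ : NoInfiniteAntichain P → ∀ x → ∃[ M ] MaximalAntichain.set {P = P} M x
    maximalAntichain-∋ noac x =
      let ((xs , pairs , x∈) , ¬ext) = Extending.inextensible noac x
      in listAntichain xs pairs ¬ext , lift (lose x∈ Eq.refl)

    comparable⇒≈ : (M : MaximalAntichain P) → ∀ {x y} → set M x → set M y → Comparable x y → x ≈ y
    comparable⇒≈ M Mx My cmp = by-contradiction λ x≉y → isAntichain M Mx My x≉y cmp

    module _ (wf : WellFounded _<_) where

      MinimalIncomparable : Carrier → Carrier → Set (c ⊔ ℓ₁ ⊔ ℓ₂)
      MinimalIncomparable x y = Incomparable x y × (∀ z → z < y → ¬ Incomparable x z)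

      minimalIncomparable-≤ : ∀ {x y} → Incomparable x y → ∃[ z ] z ≤ y × MinimalIncomparable x z
      minimalIncomparable-≤ {x} {y} x∥y =
        let (z , (x∥z , z≤y) , least) =
              minimal (λ z → Incomparable x z × z ≤ y) (wf y) (x∥y , ≤-refl)
        in z , z≤y , x∥z , λ w w<z x∥w → least w w<z (x∥w , ≤-trans (proj₁ w<z) z≤y)

      minimal-≈ : ∀ {x y z} → MinimalIncomparable x y → MinimalIncomparable x z → y ≤ z → y ≈ z
      minimal-≈ (x∥y , _) (_ , least) y≤z = by-contradiction λ y≉z → least _ (y≤z , y≉z) x∥y

      minimalAntichain : Carrier → MaximalAntichain P
      minimalAntichain x = record
        { set         = In
        ; isAntichain = antichain
        ; maximal     = maximal′
        }
        where
        In : Subset P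
        In y = y ≈ x ⊎ MinimalIncomparable x y

        antichain : IsAntichain P In
        antichain (inj₁ y≈x) (inj₁ z≈x) y≉z cmp = y≉z (Eq.trans y≈x (Eq.sym z≈x))
        antichain (inj₁ y≈x) (inj₂ (x∥z , _)) y≉z cmp = x∥z (comparable-resp y≈x Eq.refl cmp)
        antichain (inj₂ (x∥y , _)) (inj₁ z≈x) y≉z cmp =
          x∥y (comparable-resp z≈x Eq.refl (Sum.swap cmp))
        antichain (inj₂ my) (inj₂ mz) y≉z (inj₁ y≤z) = y≉z (minimal-≈ my mz y≤z)
        antichain (inj₂ my) (inj₂ mz) y≉z (inj₂ z≤y) = y≉z (Eq.sym (minimal-≈ mz my z≤y))

        maximal′ : ∀ Y → IsAntichain P Y → In ⊆′ Y → Y ⊆′ In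
        maximal′ Y acY ⊆Y {y} Yy with em {P = y ≈ x}
        ... | yes y≈x = inj₁ y≈x
        ... | no y≉x =
          -- A minimal incomparable `z` below `y` lies in the antichain `Y`, as does `y`; hence they
          -- coincide.
          let x∥y = λ cmp → acY Yy (⊆Y (inj₁ Eq.refl)) y≉x (Sum.swap cmp)
              (z , z≤y , mz) = minimalIncomparable-≤ x∥y
              z≈y = by-contradiction λ z≉y → acY (⊆Y (inj₂ mz)) Yy z≉y (inj₁ z≤y)
          in inj₂ (x∥y , λ w w<y → proj₂ mz w (<-respʳ-≈ (Eq.sym z≈y) w<y))

      private
        module Dominated {x y} (⊑ : _⊑_ P (minimalAntichain x) (minimalAntichain y)) where
          -- Some member `w` dominates `x`, so `z` and `w` would be distinct comparable members.
          no-member-below : ∀ {z} → set (minimalAntichain y) z → ¬ z < x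
          no-member-below {z} z∈ z<x =
            let (w , w∈ , x≤w) = ⊑ x (inj₁ Eq.refl)
                z<w = <-≤-trans z<x x≤w
            in proj₂ z<w (comparable⇒≈ (minimalAntichain y) z∈ w∈ (inj₁ (proj₁ z<w)))

      -- If `z < x` failed to be below `y`, then `y` itself or a minimal element incomparable to `y`
      -- would lie below `z`, giving a member below `x`.
      minimalAntichain-reflects-≤pred : ∀ {x y} →
        _⊑_ P (minimalAntichain x) (minimalAntichain y) → _≤pred_ P x y
      minimalAntichain-reflects-≤pred {x} {y} ⊑ z z<x with em {P = Comparable y z}
      ... | yes (inj₁ y≤z) = contradiction (≤-<-trans y≤z z<x) (no-member-below (inj₁ Eq.refl))
        where open Dominated ⊑
      ... | yes (inj₂ z≤y) = z≤y , λ z≈y → no-member-below (inj₁ z≈y) z<x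
        where open Dominated ⊑
      ... | no y∥z = let (w , w≤z , mw) = minimalIncomparable-≤ y∥z in
        contradiction (≤-<-trans w≤z z<x) (no-member-below (inj₂ mw))
        where open Dominated ⊑

    -- From a bad map into `AM(P)` to one into `P`

    private
      -- f s is finite, so after fusion the element of f s witnessing that f s is not
      -- dominated by f t can be chosen independently of t.
      module Selection (noac : NoInfiniteAntichain P) (𝔅 : Barrier)
          (f : List ℕ → MaximalAntichain P) (bad : Bad (AM P) (Barrier.Member 𝔅) f) where
        open Barrier 𝔅 using () renaming (Member to B)
        open BarrierProperties 𝔅

        -- Membership is up to `≈` because finiteness lists the elements of `f s` only up to `≈`.
        Escapes : List ℕ → List ℕ → Carrier → Set _
        Escapes s t x = (∃[ y ] set (f s) y × y ≈ x) × (∀ z → set (f t) z → ¬ x ≤ z)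

        -- The conditions on `s` are premises because fusion runs over every finite `s`, member or
        -- not.
        Chosen : List ℕ → Pred ℕ 0ℓ → Carrier → Set _
        Chosen s Z x = ∀ {r} → B (drop 1 s ++ r) → All Z r → B s → s ◁ (drop 1 s ++ r) →
                       Escapes s (drop 1 s ++ r) x

        escape : B s → B t → s ◁ t → ∃[ x ] set (f s) x × (∀ z → set (f t) z → ¬ x ≤ z)
        escape p q s◁t =
          let (x , h) = counterexample (bad p q s◁t)
              (x∈ , h′) = counterexample h
          in x , x∈ , λ z z∈ x≤z → h′ (z , z∈ , x≤z)

        -- Heads the list of colours and serves the `r` for which `s` is not a member or `◁` fails.
        -- Badness at one pair supplies an element of `P`.
        default : Carrier
        default =
          let (_ , _ , _ , p , _) = ⋃-unbounded 0
              (_ , q , s◁ , _) = successor p ⋃-unbounded id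
          in proj₁ (escape p q s◁)

        finite : ∀ s → Finite (Poset.Eq.setoid P) (set (f s))
        finite s = by-contradiction (noac (set (f s)) (isAntichain (f s)))

        choose : ∀ s {Y} → Unbounded Y → ∃[ Z ] Unbounded Z × Z ⊆′ Y × ∃ (Chosen s Z)
        choose s ub = nash-williams-finite (thin-++ thin (drop 1 s)) (bar-++ bar (drop 1 s))
          default (proj₁ (finite s))
          (λ x r → B s → s ◁ (drop 1 s ++ r) → Escapes s (drop 1 s ++ r) x) ub some
          where
          some : ∀ {r} → B (drop 1 s ++ r) → _ → Any _ (default ∷ proj₁ (finite s))
          some {r} q _ with em {P = B s × s ◁ (drop 1 s ++ r)}
          ... | no ¬p = here (λ p s◁ → contradiction (p , s◁) ¬p)
          ... | yes (p , s◁) =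
            let (x , x∈ , h) = escape p q s◁
            in there (Any.map (λ x≈y _ _ → (x , x∈ , x≈y) , λ z z∈ y≤z →
                 h z z∈ (≤-trans (≤-reflexive x≈y) y≤z)) (proj₂ (finite s) x x∈))

        module _ (ubX : Unbounded X) (X⊆ : X ⊆′ ⋃ B)
                 (chosen : ∀ {s} → Increasing s → All X s → ∃ (Chosen s (X beyond s))) where
          select : List ℕ → Carrier
          select s with em {P = Increasing s × All X s}
          ... | yes (inc , Xs) = proj₁ (chosen inc Xs)
          ... | no _           = default

          select-chosen : Increasing s → All X s → Chosen s (X beyond s) (select s)
          select-chosen {s} inc Xs with em {P = Increasing s × All X s}
          ... | yes (inc , Xs) = proj₂ (chosen inc Xs)
          ... | no ¬p          = contradiction (inc , Xs) ¬p

          select-escapes : B s → B t → All X s → All X t → s ◁ t → Escapes s t (select s)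
          select-escapes {s} {t} p q Xs Xt s◁t =
            let (c , t≡ , s<c) = ◁-tail (nonempty p) s◁t
                Xc = proj₂ (++⁻ (drop 1 s) (subst (All X) t≡ Xt))
            in subst (λ t → Escapes s t (select s)) (sym t≡)
                 (select-chosen (proj₁ thin p) Xs (subst B t≡ q) (All.zip (Xc , s<c)) p
                   (subst (s ◁_) t≡ s◁t))

          select-bad : Bad (Poset.preorder P) (Barrier.Member (restrict ubX X⊆)) select
          select-bad (p , Xs) (q , Xt) s◁t le =
            -- A successor of `t` shows that `select t` belongs to `f t` up to `≈`, which `select s`
            -- escapes.
            let (_ , q′ , t◁ , Xr) = successor q ubX X⊆
                ((y , y∈ , y≈) , _) =
                  select-escapes q q′ Xt (++⁺ (drop⁺ 1 Xt) (All.map proj₁ Xr)) t◁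
            in proj₂ (select-escapes p q Xs Xt s◁t) y y∈ (≤-trans le (≤-reflexive (Eq.sym y≈)))

        selection : ∃[ X ] Unbounded X × X ⊆′ ⋃ B ×
                    (∀ {s} → Increasing s → All X s → ∃ (Chosen s (X beyond s)))
        selection = diagonal (λ s Z → ∃ (Chosen s Z))
          (λ s Z⊆Y (x , h) → x , λ q Zr → h q (All.map Z⊆Y Zr)) (λ s → choose s) ⋃-unbounded

        ¬bqo : ∀ {α} → OrderTypeAtMost α 𝔅 → ¬ BQO (Poset.preorder P) α
        ¬bqo {α} o bqo =
          let (X , ubX , X⊆ , chosen) = selection
              𝔅′ = restrict ubX X⊆
          in bqo⇒¬bad (Poset.preorder P) bqo 𝔅′ (sub-orderType α 𝔅 𝔅′ proj₁ o)
               (select ubX X⊆ chosen) (select-bad ubX X⊆ chosen)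

    -- Implications between the five conditions

    module _ (noac : NoInfiniteAntichain P) {α : CountableOrdinal} where

      bqo⇒bqo-AM : BQO (Poset.preorder P) α → BQO (AM P) α
      bqo⇒bqo-AM bqo = ¬bad⇒bqo (AM P) λ 𝔅 o f bad → Selection.¬bqo noac 𝔅 f bad o bqo

      bqo-AM⇒bqo-pred : BQO (AM P) α → BQO (predPreorder P) α
      bqo-AM⇒bqo-pred bqo = ¬bad⇒bqo (predPreorder P) λ 𝔅 o f bad →
        [ (λ (p , desc) →
            -- For `i` less than `j`, domination would put a member of the antichain through `p j`
            -- above `p i`, hence strictly above `p j`.
            increasing⇒¬bqo (AM P) (λ n → proj₁ (maximalAntichain-∋ noac (p n)))
              (λ {i} {j} i<j ⊑ →
                let (M , pj∈) = maximalAntichain-∋ noac (p j)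
                    (y , y∈ , pi≤y) = ⊑ (p i) (proj₂ (maximalAntichain-∋ noac (p i)))
                    pj<y = <-≤-trans (descending-< desc i<j) pi≤y
                in proj₂ pj<y (comparable⇒≈ M pj∈ y∈ (inj₁ (proj₁ pj<y))))
              𝔅 o bqo)
        , (λ wf → bqo⇒¬bad (AM P) bqo 𝔅 o (minimalAntichain wf ∘ f) λ p q s◁t ⊑ →
            bad p q s◁t (minimalAntichain-reflects-≤pred wf ⊑))
        ]′ descending⊎wellFounded

      bqo-succ⇒bqo : BQO (succPreorder P) α → BQO (Poset.preorder P) α
      bqo-succ⇒bqo bqo = ¬bad⇒bqo (Poset.preorder P) λ 𝔅 o f bad →
        [ (λ (p , desc) → increasing⇒¬bqo (succPreorder P) p
            (λ {i} i<j h → <-irrefl Eq.refl (h (p i) (descending-< desc i<j))) 𝔅 o bqo)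
        , (λ wf →
            let (X , ubX , X⊆ , g , f<g , f≰g) = separated noac wf 𝔅 f bad
                𝔅′ = BarrierProperties.restrict 𝔅 ubX X⊆
            in bqo⇒¬bad (succPreorder P) bqo 𝔅′ (sub-orderType α 𝔅 𝔅′ proj₁ o) f
                 λ {_} {t} (p , Xs) (q , Xt) s◁t h →
                   f≰g p q Xs Xt s◁t (proj₁ (h (g t) (f<g q Xt))))
        ]′ descending⊎wellFounded

      bqo-pred⇒bqo : BQO (predPreorder P) α → BQO (Poset.preorder P) α
      bqo-pred⇒bqo bqo = ¬bad⇒bqo (Poset.preorder P) λ 𝔅 o f bad →
        [ (λ (p , desc) → increasing⇒¬bqo (predPreorder P) p
            (λ {_} {j} i<j h → <-irrefl Eq.refl (h (p j) (descending-< desc i<j))) 𝔅 o bqo)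
        , (λ wf →
            let (X , ubX , X⊆ , g , f<g , f≰g) = separated noac wf 𝔅 f bad
                𝔅′ = BarrierProperties.restrict 𝔅 ubX X⊆
            in bqo⇒¬bad (predPreorder P) bqo 𝔅′ (sub-orderType α 𝔅 𝔅′ proj₁ o) g
                 λ {s} (p , Xs) (q , Xt) s◁t h →
                   f≰g p q Xs Xt s◁t (proj₁ (h (f s) (f<g p Xs))))
        ]′ descending⊎wellFounded

    bqo⇒bqo-crit : ∀ {α} → BQO (Poset.preorder P) α → BQO (critPreorder P) α
    bqo⇒bqo-crit bqo 𝔅 o f =
      let (s , t , s◁t , le) = bqo 𝔅 o f
      in s , t , s◁t , (λ _ x<fs → <-≤-trans x<fs le) , (λ _ ft<y → ≤-<-trans le ft<y)

    bqo-crit⇒bqo-pred : ∀ {α} → BQO (critPreorder P) α → BQO (predPreorder P) α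
    bqo-crit⇒bqo-pred bqo 𝔅 o f = let (s , t , s◁t , le , _) = bqo 𝔅 o f in s , t , s◁t , le

    bqo-crit⇒bqo-succ : ∀ {α} → BQO (critPreorder P) α → BQO (succPreorder P) α
    bqo-crit⇒bqo-succ bqo 𝔅 o f = let (s , t , s◁t , _ , le) = bqo 𝔅 o f in s , t , s◁t , le

theorem5p5 : (∀ {ℓ} → ExcludedMiddle ℓ) →
    ∀ {c ℓ₁ ℓ₂} (P : Poset c ℓ₁ ℓ₂) (α : CountableOrdinal) →
    NoInfiniteAntichain P →
    (BQO (Poset.preorder P) α ⇔ BQO (succPreorder P) α) ×
    (BQO (Poset.preorder P) α ⇔ BQO (predPreorder P) α) ×
    (BQO (Poset.preorder P) α ⇔ BQO (critPreorder P) α) ×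
    (BQO (Poset.preorder P) α ⇔ BQO (AM P) α)
theorem5p5 em P α noac =
  mk⇔ (bqo-crit⇒bqo-succ em P ∘ bqo⇒bqo-crit em P) (bqo-succ⇒bqo em P noac) ,
  mk⇔ (bqo-crit⇒bqo-pred em P ∘ bqo⇒bqo-crit em P) (bqo-pred⇒bqo em P noac) ,
  mk⇔ (bqo⇒bqo-crit em P) (bqo-pred⇒bqo em P noac ∘ bqo-crit⇒bqo-pred em P) ,
  mk⇔ (bqo⇒bqo-AM em P noac) (bqo-pred⇒bqo em P noac ∘ bqo-AM⇒bqo-pred em P noac)
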